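{- Let $q,m,k,s_1,\ldots,s_u$ be positive integers such that $q$ is a prime power and $m\leq q$. Assume that there exist a weighing matrix of order $m$ and weight $k$ and an orthogonal design of order $m$ and type $(s_1,\ldots,s_u)$. Then: (1) there exist $m$ mutually unbiased orthogonal designs of order $mq$ and type $(ks_1,\ldots,ks_u)$ with parameter $\alpha=k^2$; (2) for every nonempty subset $S\subseteq\{1,\ldots,u\}$ there exist $m$ mutually quasi-unbiased weighing matrices for the parameters $\left(mq,\;k\sum_{i\in S}s_i,\;k^2,\;(\sum_{i\in S}s_i)^2\right)$.
   Context: A weighing matrix of order $n$ and weight $k$ is an $n\times n$ matrix $W$ with entries in $\{0,1,-1\}$ such that $WW^\top=kI_n$. Let $x_1,\ldots,x_u$ be distinct commuting real indeterminates. An orthogonal design of order $n$ and type $(s_1,\ldots,s_u)$ in the variables $x_1,\ldots,x_u$ is an $n\times n$ matrix $D$ with entries in $\{0,\pm x_1,\ldots,\pm x_u\}$ such that $DD^\top=(s_1x_1^2+\cdots+s_ux_u^2)I_n$. Two orthogonal designs $D_1,D_2$ of order $n$ and type $(s_1,\ldots,s_u)$ in the same variables are unbiased with parameter $\alpha$ if $\alpha$ is a positive real number and there is a $(0,1,-1)$-matrix $W$ with $D_1D_2^\top=\frac{s_1x_1^2+\cdots+s_ux_u^2}{\sqrt{\alpha}}W$; a family is mutually unbiased with parameter $\alpha$ if any two distinct members are. Two weighing matrices $W_1,W_2$ of order $n$ and weight $k$ are quasi-unbiased for parameters $(n,k,l,a)$ if $\frac{1}{\sqrt a}W_1W_2^\top$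 is a weighing matrix of order $n$ and weight $l$; a family is mutually quasi-unbiased for these parameters if any two distinct members are. -}

module Defs where

open import Algebra.Bundles using (CommutativeRing)
open import Algebra.Structures using (IsCommutativeRing)
import Algebra.Properties.Semiring.Sum as SemiringSum
open import Data.Bool.Base using (if_then_else_)
open import Data.Fin.Base using (Fin)
open import Data.Fin.Properties using (_≟_)
open import Data.Fin.Subset using (Subset)
open import Data.Fin.Subset.Properties using (_∈?_)
open import Data.Integer.Base using (+_)
open import Data.Nat.Base as ℕ using (ℕ)
import Data.Nat.Properties as ℕ
open import Data.Nat.Primality using (Prime)
open import Data.Product.Base using (_×_; _,_; ∃-syntax)
open import Data.Rational.Base as ℚ using (ℚ; 0ℚ; 1ℚ)
import Data.Rational.Properties as ℚ
open import Data.Sum.Base using (_⊎_)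
open import Function.Definitions using (Injective)
open import Level using (0ℓ)
open import Relation.Binary.PropositionalEquality using (_≡_; _≢_)
open import Relation.Nullary.Decidable.Core using (does)

IsPrimePower : ℕ → Set
IsPrimePower q = ∃[ p ] ∃[ e ] Prime p × 0 ℕ.< e × q ≡ p ℕ.^ e

sumOver : ∀ {u} → Subset u → (Fin u → ℕ) → ℕ
sumOver S s = sum λ i → if does (i ∈? S) then s i else 0
  where open SemiringSum ℕ.+-*-semiring using (sum)

fromℕ : ℕ → ℚ
fromℕ n = + n ℚ./ 1

-- Scalars are rational rather than real.  Nothing is lost when the square root
-- of the parameter is rational, since a positive square root is unique; for
-- matrices of positive order and positive type or weight, the integrality of
-- D₁D₂ᵀ (resp. W₁W₂ᵀ) forces that root to be rational anyway.
record PositiveSqrt (α : ℚ) : Set where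
  field
    root          : ℚ
    root-positive : ℚ.Positive root
    root²≡α       : root ℚ.* root ≡ α

  -- 1/√α
  inverse : ℚ
  inverse = (ℚ.1/ root) {{ℚ.pos⇒nonZero root {{root-positive}}}}

module Matrices {c ℓ} (R : CommutativeRing c ℓ) where
  open CommutativeRing R
  open SemiringSum semiring using (sum)

  Matrix : ℕ → ℕ → Set c
  Matrix m n = Fin m → Fin n → Carrier

  infix  4 _≋_
  infixl 7 _⊗_
  infixr 7 _•_
  infix  8 _ᵀ

  _≋_ : ∀ {m n} → Matrix m n → Matrix m n → Set ℓ
  A ≋ B = ∀ i j → A i j ≈ B i j

  _ᵀ : ∀ {m n} → Matrix m n → Matrix n m
  (A ᵀ) i j = A j i

  _⊗_ : ∀ {m n p} → Matrix m n → Matrix n p → Matrix m p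
  (A ⊗ B) i j = sum λ l → A i l * B l j

  _•_ : ∀ {m n} → Carrier → Matrix m n → Matrix m n
  (x • A) i j = x * A i j

  𝕀 : ∀ {n} → Matrix n n
  𝕀 i j = if does (i ≟ j) then 1# else 0#

-- The polynomial ring ℚ[x₁,…,x_u], presented as the free commutative
-- ℚ-algebra on u generators: terms modulo the congruence generated by the
-- commutative ring laws and by con being a ring homomorphism.
module Polynomials (u : ℕ) where

  infixl 6 _+_
  infixl 7 _*_
  infix  8 -_
  infix  4 _≈_

  data Poly : Set where
    con : ℚ → Poly
    var : Fin u → Poly
    _+_ : Poly → Poly → Poly
    _*_ : Poly → Poly → Poly
    -_  : Poly → Poly

  data _≈_ : Poly → Poly → Set where
    refl        : ∀ {f} → f ≈ f
    sym         : ∀ {f g} → f ≈ g → g ≈ f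
    trans       : ∀ {f g h} → f ≈ g → g ≈ h → f ≈ h
    +-cong      : ∀ {f f′ g g′} → f ≈ f′ → g ≈ g′ → f + g ≈ f′ + g′
    *-cong      : ∀ {f f′ g g′} → f ≈ f′ → g ≈ g′ → f * g ≈ f′ * g′
    neg-cong    : ∀ {f f′} → f ≈ f′ → - f ≈ - f′
    +-assoc     : ∀ f g h → (f + g) + h ≈ f + (g + h)
    +-comm      : ∀ f g → f + g ≈ g + f
    +-identityʳ : ∀ f → f + con 0ℚ ≈ f
    +-inverseʳ  : ∀ f → f + (- f) ≈ con 0ℚ
    *-assoc     : ∀ f g h → (f * g) * h ≈ f * (g * h)
    *-comm      : ∀ f g → f * g ≈ g * f
    *-identityʳ : ∀ f → f * con 1ℚ ≈ f
    *-distribˡ  : ∀ f g h → f * (g + h) ≈ f * g + f * h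
    con-+       : ∀ a b → con (a ℚ.+ b) ≈ con a + con b
    con-*       : ∀ a b → con (a ℚ.* b) ≈ con a * con b

  isCommutativeRing : IsCommutativeRing _≈_ _+_ _*_ -_ (con 0ℚ) (con 1ℚ)
  isCommutativeRing = record
    { isRing = record
      { +-isAbelianGroup = record
        { isGroup = record
          { isMonoid = record
            { isSemigroup = record
              { isMagma = record
                { isEquivalence = record { refl = refl ; sym = sym ; trans = trans }
                ; ∙-cong        = +-cong
                }
              ; assoc = +-assoc
              }
            ; identity = (λ f → trans (+-comm _ f) (+-identityʳ f)) , +-identityʳ
            }
          ; inverse = (λ f → trans (+-comm _ f) (+-inverseʳ f)) , +-inverseʳ
          ; ⁻¹-cong = neg-cong
          }
        ; comm = +-comm
        }
      ; *-cong     = *-cong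
      ; *-assoc    = *-assoc
      ; *-identity = (λ f → trans (*-comm _ f) (*-identityʳ f)) , *-identityʳ
      ; distrib    = *-distribˡ ,
                     λ f g h → trans (*-comm (g + h) f)
                              (trans (*-distribˡ f g h)
                                     (+-cong (*-comm f g) (*-comm f h)))
      }
    ; *-comm = *-comm
    }

  commutativeRing : CommutativeRing 0ℓ 0ℓ
  commutativeRing = record { isCommutativeRing = isCommutativeRing }

module ℚ-Mat = Matrices ℚ.+-*-commutativeRing

module _ where
  open ℚ-Mat

  IsTernary : ∀ {m n} → Matrix m n → Set
  IsTernary W = ∀ i j → W i j ≡ 0ℚ ⊎ W i j ≡ 1ℚ ⊎ W i j ≡ ℚ.- 1ℚ

  IsWeighingMatrix : (n k : ℕ) → Matrix n n → Set
  IsWeighingMatrix n k W = IsTernary W × W ⊗ W ᵀ ≋ fromℕ k • 𝕀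

  QuasiUnbiased : (n k l : ℕ) (a : ℚ) → Matrix n n → Matrix n n → Set
  QuasiUnbiased n k l a W₁ W₂ =
    IsWeighingMatrix n k W₁ ×
    IsWeighingMatrix n k W₂ ×
    (∃[ √a ] IsWeighingMatrix n l (PositiveSqrt.inverse {a} √a • (W₁ ⊗ W₂ ᵀ)))

  -- Injectivity makes the N members genuinely distinct, so that "any two
  -- distinct members" is the same as "any two distinct indices".  It is not
  -- automatic: for instance, a weighing matrix of weight 1 is quasi-unbiased
  -- with itself for l = a = 1.
  MutuallyQuasiUnbiased : (n k l : ℕ) (a : ℚ) {N : ℕ} → (Fin N → Matrix n n) → Set
  MutuallyQuasiUnbiased n k l a W =
    (∀ i → IsWeighingMatrix n k (W i)) ×
    Injective _≡_ _≋_ W ×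
    (∀ i j → i ≢ j → QuasiUnbiased n k l a (W i) (W j))

module OrthogonalDesigns {u : ℕ} where
  open Polynomials u public
  open Matrices commutativeRing public
  open SemiringSum (CommutativeRing.semiring commutativeRing) using (sum)

  -- s₁x₁² + ⋯ + s_u x_u²
  quadraticForm : (Fin u → ℕ) → Poly
  quadraticForm s = sum λ i → con (fromℕ (s i)) * (var i * var i)

  IsOrthogonalDesign : (n : ℕ) → (Fin u → ℕ) → Matrix n n → Set
  IsOrthogonalDesign n s D =
    (∀ i j → D i j ≈ con 0ℚ ⊎ (∃[ l ] (D i j ≈ var l ⊎ D i j ≈ - var l))) ×
    D ⊗ D ᵀ ≋ quadraticForm s • 𝕀

  Unbiased : (n : ℕ) → (Fin u → ℕ) → (α : ℚ) → Matrix n n → Matrix n n → Set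
  Unbiased n s α D₁ D₂ =
    IsOrthogonalDesign n s D₁ ×
    IsOrthogonalDesign n s D₂ ×
    (∃[ √α ] ∃[ W ] IsTernary W ×
      D₁ ⊗ D₂ ᵀ ≋ (quadraticForm s * con (PositiveSqrt.inverse {α} √α)) • (λ i j → con (W i j)))

  MutuallyUnbiased : (n : ℕ) → (Fin u → ℕ) → (α : ℚ) {N : ℕ} → (Fin N → Matrix n n) → Set
  MutuallyUnbiased n s α D =
    (∀ i → IsOrthogonalDesign n s (D i)) ×
    Injective _≡_ _≋_ D ×
    (∀ i j → i ≢ j → Unbiased n s α (D i) (D j))

{-# OPTIONS --safe #-}

-- Let F be the field with q elements. The points (b , y), with b in an m-element subset of F and
-- y in F, carry m + 1 parallel classes of q lines with m points each, any two lines of distinct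
-- classes meeting in at most one point: the lines y = t b + x for m + 1 slopes t, or, if m = q,
-- for all slopes together with the vertical lines. Placing a copy of W on every line of class
-- t + 1 gives L_t, and placing a copy of the orthogonal design on every line of class 0 gives M.
-- Then D_t = L_t M has entries 0 or ± x_i, because a line of class t + 1 and a line of class 0
-- share at most one point; D_t D_t′ᵀ = (Σ s_i x_i²) L_t L_t′ᵀ; and L_t L_t′ᵀ is a (0,1,-1)-matrix
-- for t ≠ t′, of weight k² since WWᵀ = k𝕀 forces WᵀW = k𝕀. The second part is the specialisation
-- of x_i to the indicator of S.
--
-- For q = p^e the field is found as a quotient of the group algebra 𝔽_p[x]/(x^(q-1) - 1), in which
-- a^q = a for all a, so that every a^(q-1) is idempotent. The product of the x^(p^d - 1) - 1 with
-- 0 < d < e is nonzero there, by degree; a minimal idempotent below its (q-1)-th power cuts out a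
-- field in which x has e distinct conjugates. A relation over 𝔽_p between 1, x, …, x^(e-1) would
-- vanish at all of them, so these powers are independent and the field has at least q elements;
-- as all of its elements are roots of X^q - X, it has exactly q.
module Submission where

open import Defs
open import Algebra.Bundles using (CommutativeRing; Semiring)
open import Algebra.Structures using (IsAbelianGroup)
import Algebra.Properties.CommutativeSemiring.Binomial as Binomial
import Algebra.Properties.CommutativeSemiring.Exp as Exp
import Algebra.Properties.CommutativeSemigroup as CommutativeSemigroup
import Algebra.Properties.Ring as RingProperties
import Algebra.Properties.Semiring.Mult as Mult
import Algebra.Properties.Semiring.Sum as SemiringSum
import Algebra.Solver.Ring.NaturalCoefficients.Default as NatSolver
open import Data.Bool.Base using (true; false; if_then_else_)
open import Data.Empty using (⊥; ⊥-elim)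
open import Data.Fin.Base as Fin
  using (Fin; zero; suc; toℕ; fromℕ<; inject≤; combine; remQuot; quotient; remainder; finToFun; funToFin)
open import Data.Fin.Permutation using (Permutation′; permutation; _⟨$⟩ʳ_; _⟨$⟩ˡ_; inverseˡ)
import Data.Fin.Properties as Fin
open import Data.Fin.Subset using (Subset; Nonempty; ⊤)
open import Data.Fin.Subset.Properties using (_∈?_; ∈⊤)
open import Data.Integer.Base as ℤ using (ℤ; +_)
import Data.Integer.DivMod as ℤ
import Data.Integer.Divisibility.Signed as ℤ
import Data.Integer.Properties as ℤ
import Data.Integer.Solver as ℤ
open import Data.Nat.Base as ℕ using (ℕ; zero; suc)
open import Data.Nat.Combinatorics using (_C_; nCn≡1; nC1≡n; nCk+nC[k+1]≡[n+1]C[k+1]; k>n⇒nCk≡0)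
open import Data.Nat.Coprimality using (prime⇒coprime; coprime-divisor; coprime-Bézout)
open import Data.Nat.DivMod using (_mod_; _%_; m%n<n; %-distribˡ-+; n%n≡0; m<n⇒m%n≡m)
open import Data.Nat.Divisibility using (_∣_; divides; ∣⇒≤)
open import Data.Nat.GCD using (module Bézout)
open import Data.Nat.Primality using (Prime; ¬prime[0]; prime⇒nonZero; prime⇒nonTrivial)
import Data.Nat.Properties as ℕ
open import Data.Product.Base using (_×_; _,_; ∃-syntax; proj₁; proj₂)
open import Data.Rational.Base as ℚ using (ℚ; 0ℚ; 1ℚ)
import Data.Rational.Properties as ℚ
open import Data.Rational.Solver using (module +-*-Solver)
open import Data.Rational.Unnormalised.Base using (mkℚᵘ; *≡*) renaming (_≃_ to _≃ᵘ_)
import Data.Rational.Unnormalised.Properties as ℚᵘ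
open import Data.Sum.Base using (_⊎_; inj₁; inj₂)
open import Function.Base using (_∘_; id; case_of_)
open import Function.Definitions using (Injective)
open import Level using (0ℓ; _⊔_)
open import Relation.Binary.Definitions using (tri<; tri≈; tri>)
open import Relation.Binary.PropositionalEquality as ≡ using (_≡_; _≢_)
import Relation.Binary.Reasoning.Setoid as SetoidReasoning
open import Relation.Nullary using (¬_; Dec; yes; no)
open import Relation.Nullary.Decidable using (does; dec-true; dec-false; map′; _×-dec_)

-- Rings of prime characteristic

-- The absorption identity for binomial coefficients. Pascal's rule splits the left side, the
-- induction hypothesis applies to both parts, and Pascal's rule recombines them.
[1+k]*[1+n]C[1+k]≡[1+n]*nCk : ∀ n k → suc k ℕ.* (suc n C suc k) ≡ suc n ℕ.* (n C k)
[1+k]*[1+n]C[1+k]≡[1+n]*nCk zero    zero    = ≡.refl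
[1+k]*[1+n]C[1+k]≡[1+n]*nCk zero    (suc k) = begin
  suc (suc k) ℕ.* (1 C suc (suc k)) ≡⟨ ≡.cong (suc (suc k) ℕ.*_) (k>n⇒nCk≡0 (ℕ.s≤s (ℕ.s≤s (ℕ.z≤n {k})))) ⟩
  suc (suc k) ℕ.* 0                 ≡⟨ ℕ.*-zeroʳ (suc (suc k)) ⟩
  0                                 ≡⟨ ≡.cong (1 ℕ.*_) (k>n⇒nCk≡0 (ℕ.s≤s (ℕ.z≤n {k}))) ⟨
  1 ℕ.* (0 C suc k)                 ∎
  where open ≡.≡-Reasoning
[1+k]*[1+n]C[1+k]≡[1+n]*nCk (suc n) zero    = begin
  1 ℕ.* (suc (suc n) C 1) ≡⟨ ℕ.*-identityˡ _ ⟩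
  suc (suc n) C 1         ≡⟨ nC1≡n (suc (suc n)) ⟩
  suc (suc n)             ≡⟨ ℕ.*-identityʳ _ ⟨
  suc (suc n) ℕ.* 1       ∎
  where open ≡.≡-Reasoning
[1+k]*[1+n]C[1+k]≡[1+n]*nCk (suc n) (suc k) = begin
  suc (suc k) ℕ.* (suc (suc n) C suc (suc k))
    ≡⟨ ≡.cong (suc (suc k) ℕ.*_) (nCk+nC[k+1]≡[n+1]C[k+1] (suc n) (suc k)) ⟨
  suc (suc k) ℕ.* (b ℕ.+ (suc n C suc (suc k)))
    ≡⟨ ℕ.*-distribˡ-+ (suc (suc k)) b _ ⟩
  suc (suc k) ℕ.* b ℕ.+ suc (suc k) ℕ.* (suc n C suc (suc k))
    ≡⟨ ≡.cong (suc (suc k) ℕ.* b ℕ.+_) ([1+k]*[1+n]C[1+k]≡[1+n]*nCk n (suc k)) ⟩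
  suc (suc k) ℕ.* b ℕ.+ suc n ℕ.* (n C suc k)
    ≡⟨ ℕ.+-assoc b (suc k ℕ.* b) _ ⟩
  b ℕ.+ (suc k ℕ.* b ℕ.+ suc n ℕ.* (n C suc k))
    ≡⟨ ≡.cong (λ z → b ℕ.+ (z ℕ.+ suc n ℕ.* (n C suc k))) ([1+k]*[1+n]C[1+k]≡[1+n]*nCk n k) ⟩
  b ℕ.+ (suc n ℕ.* (n C k) ℕ.+ suc n ℕ.* (n C suc k))
    ≡⟨ ≡.cong (b ℕ.+_) (ℕ.*-distribˡ-+ (suc n) (n C k) (n C suc k)) ⟨
  b ℕ.+ suc n ℕ.* ((n C k) ℕ.+ (n C suc k))
    ≡⟨ ≡.cong (λ z → b ℕ.+ suc n ℕ.* z) (nCk+nC[k+1]≡[n+1]C[k+1] n k) ⟩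
  suc (suc n) ℕ.* b ∎
  where
  open ≡.≡-Reasoning
  b = suc n C suc k

-- By the absorption identity the prime divides `suc j` times the binomial coefficient, and it is
-- coprime to the smaller number `suc j`.
prime∣binomial : ∀ {n} j → Prime (suc n) → suc j ℕ.< suc n → suc n ∣ (suc n C suc j)
prime∣binomial {n} j p j<n =
  coprime-divisor (prime⇒coprime p j<n)
    (divides (n C j) (≡.trans ([1+k]*[1+n]C[1+k]≡[1+n]*nCk n j) (ℕ.*-comm (suc n) (n C j))))

CharacteristicDivides : ∀ {c ℓ} → CommutativeRing c ℓ → ℕ → Set ℓ
CharacteristicDivides A p = p · 1# ≈ 0#
  where
  open CommutativeRing A hiding (zero)
  open Mult semiring renaming (_×_ to _·_)

module Powers {c ℓ} (A : CommutativeRing c ℓ) where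
  open CommutativeRing A hiding (zero)
  open Exp commutativeSemiring public
  open Mult semiring public renaming (_×_ to _·_)
  open RingProperties ring public
  open SetoidReasoning setoid

  1^n≈1 : ∀ n → 1# ^ n ≈ 1#
  1^n≈1 zero    = refl
  1^n≈1 (suc n) = trans (*-identityˡ _) (1^n≈1 n)

  ^-identityʳ : ∀ a → a ^ 1 ≈ a
  ^-identityʳ = *-identityʳ

  [n·1]*a≈n·a : ∀ n a → (n · 1#) * a ≈ n · a
  [n·1]*a≈n·a n a = trans (×-assoc-* n 1# a) (×-congʳ n (*-identityˡ a))

  a-b≈0⇒a≈b : ∀ {a b} → a - b ≈ 0# → a ≈ b
  a-b≈0⇒a≈b {a} {b} a-b≈0 = begin
    a           ≈⟨ +-identityʳ a ⟨
    a + 0#      ≈⟨ +-congˡ (-‿inverseˡ b) ⟨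
    a + (- b + b) ≈⟨ +-assoc a (- b) b ⟨
    a - b + b   ≈⟨ +-congʳ a-b≈0 ⟩
    0# + b      ≈⟨ +-identityˡ b ⟩
    b           ∎

  a≈b⇒a-b≈0 : ∀ {a b} → a ≈ b → a - b ≈ 0#
  a≈b⇒a-b≈0 {a} {b} a≈b = trans (+-congʳ a≈b) (-‿inverseʳ b)

  a+b≈c⇒a≈c-b : ∀ {a b c} → a + b ≈ c → a ≈ c - b
  a+b≈c⇒a≈c-b {a} {b} {c} e = begin
    a           ≈⟨ +-identityʳ a ⟨
    a + 0#      ≈⟨ +-congˡ (-‿inverseʳ b) ⟨
    a + (b - b) ≈⟨ +-assoc a b (- b) ⟨
    a + b - b   ≈⟨ +-congʳ e ⟩
    c - b       ∎

  [a-b]+b≈a : ∀ a b → (a - b) + b ≈ a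
  [a-b]+b≈a a b = trans (+-assoc a (- b) b) (trans (+-congˡ (-‿inverseˡ b)) (+-identityʳ a))

module Frobenius {c ℓ} (A : CommutativeRing c ℓ) {p : ℕ} (pp : Prime p) (char : CharacteristicDivides A p) where
  open CommutativeRing A hiding (zero)
  open Powers A
  open SetoidReasoning setoid
  open SemiringSum semiring using (sum; sum-cong-≋; sum-init-last; sum-replicate-zero)

  p∣n⇒n·a≈0 : ∀ {n} → p ∣ n → ∀ a → n · a ≈ 0#
  p∣n⇒n·a≈0 (divides k ≡.refl) a = begin
    (k ℕ.* p) · a      ≈⟨ ×-assocˡ a k p ⟨
    k · (p · a)        ≈⟨ ×-congʳ k ([n·1]*a≈n·a p a) ⟨
    k · ((p · 1#) * a) ≈⟨ ×-congʳ k (*-congʳ char) ⟩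
    k · (0# * a)       ≈⟨ ×-congʳ k (zeroˡ a) ⟩
    k · 0#             ≈⟨ [n·1]*a≈n·a k 0# ⟨
    (k · 1#) * 0#      ≈⟨ zeroʳ _ ⟩
    0#                 ∎

  frobenius-+ : ∀ a b → (a + b) ^ p ≈ a ^ p + b ^ p
  frobenius-+ a b = helper pp (λ p∣n → p∣n⇒n·a≈0 p∣n)
    where
    open Binomial commutativeSemiring using (theorem; binomialTerm)
    -- The prime is a module parameter and cannot be matched against `suc n`, so it is generalised
    -- here together with the one consequence of `char` that the binomial theorem calls for.
    helper : ∀ {p} → Prime p → (∀ {n} → p ∣ n → ∀ a → n · a ≈ 0#) → (a + b) ^ p ≈ a ^ p + b ^ p
    helper {zero}  pp _    = ⊥-elim (¬prime[0] pp)
    helper {suc n} pp zero-multiple = begin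
      (a + b) ^ suc n ≈⟨ theorem (suc n) a b ⟩
      t zero + sum (λ i → t (suc i)) ≈⟨ +-congˡ (sum-init-last (λ i → t (suc i))) ⟩
      t zero + (sum (λ i → t (suc (Fin.inject₁ i))) + t (suc (Fin.fromℕ n)))
        ≈⟨ +-cong first (+-cong (trans (sum-cong-≋ middle) (sum-replicate-zero n)) last) ⟩
      b ^ suc n + (0# + a ^ suc n) ≈⟨ +-congˡ (+-identityˡ _) ⟩
      b ^ suc n + a ^ suc n        ≈⟨ +-comm _ _ ⟩
      a ^ suc n + b ^ suc n        ∎
      where
      t = binomialTerm a b (suc n)
      first : t zero ≈ b ^ suc n
      first = trans (+-identityʳ _) (*-identityˡ _)
      last : t (suc (Fin.fromℕ n)) ≈ a ^ suc n
      last rewrite Fin.toℕ-fromℕ n | nCn≡1 (suc n) | ℕ.n∸n≡0 n = trans (+-identityʳ _) (*-identityʳ _)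
      middle : ∀ i → t (suc (Fin.inject₁ i)) ≈ 0#
      middle i = zero-multiple (prime∣binomial _ pp (ℕ.s≤s (≡.subst (ℕ._< n) (≡.sym (Fin.toℕ-inject₁ i)) (Fin.toℕ<n i)))) _

  frobenius-0 : 0# ^ p ≈ 0#
  frobenius-0 = helper pp
    where
    helper : ∀ {p} → Prime p → 0# ^ p ≈ 0#
    helper {zero} pp = ⊥-elim (¬prime[0] pp)
    helper {suc p} _ = zeroˡ _

  frobenius-fix-· : ∀ n {a} → a ^ p ≈ a → (n · a) ^ p ≈ n · a
  frobenius-fix-· zero    _ = frobenius-0
  frobenius-fix-· (suc n) fix = trans (frobenius-+ _ _) (+-cong fix (frobenius-fix-· n fix))

  -- Additivity is applied to `(a - b) + b`, so no power of a negative has to be computed and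
  -- `p = 2` is no special case.
  frobenius-fix-- : ∀ {a b} → a ^ p ≈ a → b ^ p ≈ b → (a - b) ^ p ≈ a - b
  frobenius-fix-- {a} {b} fix-a fix-b = a+b≈c⇒a≈c-b (begin
    (a - b) ^ p + b       ≈⟨ +-congˡ fix-b ⟨
    (a - b) ^ p + b ^ p   ≈⟨ frobenius-+ (a - b) b ⟨
    (a - b + b) ^ p       ≈⟨ ^-congˡ p ([a-b]+b≈a a b) ⟩
    a ^ p                 ≈⟨ fix-a ⟩
    a                     ∎)

  ^-p^[1+e] : ∀ a e → a ^ (p ℕ.^ suc e) ≈ (a ^ p) ^ (p ℕ.^ e)
  ^-p^[1+e] a e = sym (^-assocʳ a p (p ℕ.^ e))

  iterated-frobenius-+ : ∀ e a b → (a + b) ^ (p ℕ.^ e) ≈ a ^ (p ℕ.^ e) + b ^ (p ℕ.^ e)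
  iterated-frobenius-+ zero    a b = trans (^-identityʳ _) (sym (+-cong (^-identityʳ a) (^-identityʳ b)))
  iterated-frobenius-+ (suc e) a b = begin
    (a + b) ^ (p ℕ.^ suc e)             ≈⟨ ^-p^[1+e] (a + b) e ⟩
    ((a + b) ^ p) ^ (p ℕ.^ e)           ≈⟨ ^-congˡ (p ℕ.^ e) (frobenius-+ a b) ⟩
    (a ^ p + b ^ p) ^ (p ℕ.^ e)         ≈⟨ iterated-frobenius-+ e (a ^ p) (b ^ p) ⟩
    (a ^ p) ^ (p ℕ.^ e) + (b ^ p) ^ (p ℕ.^ e) ≈⟨ +-cong (^-p^[1+e] a e) (^-p^[1+e] b e) ⟨
    a ^ (p ℕ.^ suc e) + b ^ (p ℕ.^ suc e)     ∎

  iterated-frobenius-0 : ∀ e → 0# ^ (p ℕ.^ e) ≈ 0#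
  iterated-frobenius-0 zero    = ^-identityʳ 0#
  iterated-frobenius-0 (suc e) =
    trans (^-p^[1+e] 0# e) (trans (^-congˡ (p ℕ.^ e) frobenius-0) (iterated-frobenius-0 e))

-- Polynomials over a domain; the field structure on Fin (p ^ e)

m+[n∸o]≡n+[m∸o] : ∀ {m n o} → o ℕ.≤ m → o ℕ.≤ n → m ℕ.+ (n ℕ.∸ o) ≡ n ℕ.+ (m ℕ.∸ o)
m+[n∸o]≡n+[m∸o] {m} {n} {o} o≤m o≤n = begin
  m ℕ.+ (n ℕ.∸ o) ≡⟨ ℕ.+-∸-assoc m o≤n ⟨
  m ℕ.+ n ℕ.∸ o   ≡⟨ ≡.cong (ℕ._∸ o) (ℕ.+-comm m n) ⟩
  n ℕ.+ m ℕ.∸ o   ≡⟨ ℕ.+-∸-assoc n o≤m ⟩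
  n ℕ.+ (m ℕ.∸ o) ∎
  where open ≡.≡-Reasoning

-- `funToFin` respects pointwise equality of functions, so it can be applied to both sides without
-- function extensionality.
finToFun-injective : ∀ {m n} (i j : Fin (n ℕ.^ m)) → (∀ k → finToFun {n} {m} i k ≡ finToFun j k) → i ≡ j
finToFun-injective {m} {n} i j eq = ≡.trans (≡.sym (Fin.funToFin-finToFin {m} {n} i))
  (≡.trans (funToFin-cong eq) (Fin.funToFin-finToFin {m} {n} j))
  where
  funToFin-cong : ∀ {m n} {f g : Fin m → Fin n} → (∀ k → f k ≡ g k) → funToFin f ≡ funToFin g
  funToFin-cong {zero}  f≡g = ≡.refl
  funToFin-cong {suc m} f≡g = ≡.cong₂ Fin.combine (f≡g zero) (funToFin-cong (f≡g ∘ suc))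

2≤p^e : ∀ {p e} → Prime p → 0 ℕ.< e → 2 ℕ.≤ p ℕ.^ e
2≤p^e {p} pp 0<e = ℕ.≤-trans (ℕ.nonTrivial⇒n>1 p)
  (ℕ.≤-trans (ℕ.≤-reflexive (≡.sym (ℕ.*-identityʳ p))) (ℕ.^-monoʳ-≤ p {{prime⇒nonZero pp}} 0<e))
  where instance _ = prime⇒nonTrivial pp

record IsDecidableDomain {c ℓ} (K : CommutativeRing c ℓ) : Set (c ⊔ ℓ) where
  open CommutativeRing K
  field
    _≈?_          : ∀ a b → Dec (a ≈ b)
    1≉0           : ¬ 1# ≈ 0#
    cancel-factor : ∀ {a b} → ¬ a ≈ 0# → a * b ≈ 0# → b ≈ 0#

module Horner {c ℓ} (K : CommutativeRing c ℓ) where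
  open CommutativeRing K hiding (zero)
  open Powers K
  open SetoidReasoning setoid
  open NatSolver commutativeSemiring using (solve; _:=_; _:+_; _:*_)

  -- A family of `n` coefficients, constant term first, stands for a polynomial of degree less than
  -- `n`.
  eval : ∀ {n} → (Fin n → Carrier) → Carrier → Carrier
  eval {zero}  f r = 0#
  eval {suc n} f r = f zero + r * eval (f ∘ suc) r

  eval-cong : ∀ {n} {f g : Fin n → Carrier} r → (∀ i → f i ≈ g i) → eval f r ≈ eval g r
  eval-cong {zero}  r f≈g = refl
  eval-cong {suc n} r f≈g = +-cong (f≈g zero) (*-congˡ (eval-cong r (f≈g ∘ suc)))

  eval-congʳ : ∀ {n} (f : Fin n → Carrier) {r s} → r ≈ s → eval f r ≈ eval f s
  eval-congʳ {zero}  f r≈s = refl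
  eval-congʳ {suc n} f r≈s = +-congˡ (*-cong r≈s (eval-congʳ (f ∘ suc) r≈s))

  eval-+ : ∀ {n} (f g : Fin n → Carrier) r → eval (λ i → f i + g i) r ≈ eval f r + eval g r
  eval-+ {zero}  f g r = sym (+-identityˡ 0#)
  eval-+ {suc n} f g r = trans (+-congˡ (*-congˡ (eval-+ (f ∘ suc) (g ∘ suc) r)))
    (solve 5 (λ a b r e e′ → (a :+ b) :+ r :* (e :+ e′) := (a :+ r :* e) :+ (b :+ r :* e′)) refl _ _ r _ _)

  monomial : ∀ n → Fin (suc n) → Carrier
  monomial zero    _       = 1#
  monomial (suc n) zero    = 0#
  monomial (suc n) (suc i) = monomial n i

  eval-monomial : ∀ n r → eval (monomial n) r ≈ r ^ n
  eval-monomial zero    r = trans (+-congˡ (zeroʳ r)) (+-identityʳ 1#)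
  eval-monomial (suc n) r = trans (+-identityˡ _) (*-congˡ (eval-monomial n r))

  monomial-leading : ∀ n → monomial n (Fin.fromℕ n) ≈ 1#
  monomial-leading zero    = refl
  monomial-leading (suc n) = monomial-leading n

  -- Synthetic division by X - r.
  quot : ∀ {n} → (Fin (suc n) → Carrier) → Carrier → Fin n → Carrier
  quot f r zero    = eval (f ∘ suc) r
  quot f r (suc i) = quot (f ∘ suc) r i

  -- This is f(x) - f(r) = (x - r) Q(x) with the negative terms moved across, so that it is an
  -- identity of semirings.
  eval-quot : ∀ {n} (f : Fin (suc n) → Carrier) r x →
              eval f x + r * eval (quot f r) x ≈ eval f r + x * eval (quot f r) x
  eval-quot {zero}  f r x = +-cong (+-congˡ (trans (zeroʳ x) (sym (zeroʳ r)))) (trans (zeroʳ r) (sym (zeroʳ x)))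
  eval-quot {suc n} f r x = begin
    (f₀ + x * Ex) + r * (Er + x * Q)
      ≈⟨ solve 6 (λ f₀ x Ex r Er Q → (f₀ :+ x :* Ex) :+ r :* (Er :+ x :* Q)
                                    := (f₀ :+ r :* Er) :+ x :* (Ex :+ r :* Q)) refl f₀ x Ex r Er Q ⟩
    (f₀ + r * Er) + x * (Ex + r * Q)
      ≈⟨ +-congˡ (*-congˡ (eval-quot (f ∘ suc) r x)) ⟩
    (f₀ + r * Er) + x * (Er + x * Q) ∎
    where
    f₀ = f zero
    Ex = eval (f ∘ suc) x
    Er = eval (f ∘ suc) r
    Q  = eval (quot (f ∘ suc) r) x

  -- The coefficients of the quotient are the values at `r` of the successive proper tails of `f`. A
  -- coefficient of `f` is the value of one tail minus `r` times the value of the next, and all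
  -- these values vanish.
  quot≈0⇒≈0 : ∀ {n} (f : Fin (suc n) → Carrier) r → eval f r ≈ 0# → (∀ i → quot f r i ≈ 0#) → ∀ i → f i ≈ 0#
  quot≈0⇒≈0 {suc n} f r fr≈0 q≈0 (suc i) = quot≈0⇒≈0 (f ∘ suc) r (q≈0 zero) (q≈0 ∘ suc) i
  quot≈0⇒≈0 {n}     f r fr≈0 q≈0 zero    = begin
    f zero            ≈⟨ +-identityʳ _ ⟨
    f zero + 0#       ≈⟨ +-congˡ (zeroʳ r) ⟨
    f zero + r * 0#   ≈⟨ +-congˡ (*-congˡ (eval-tail≈0 f q≈0)) ⟨
    eval f r          ≈⟨ fr≈0 ⟩
    0#                ∎
    where
    eval-tail≈0 : ∀ {n} (f : Fin (suc n) → Carrier) → (∀ i → quot f r i ≈ 0#) → eval (f ∘ suc) r ≈ 0#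
    eval-tail≈0 {zero}  f q≈0 = refl
    eval-tail≈0 {suc n} f q≈0 = q≈0 zero

  module _ (domain : IsDecidableDomain K) where
    open IsDecidableDomain domain

    *-cancelʳ-distinct : ∀ {a b x} → ¬ a ≈ b → a * x ≈ b * x → x ≈ 0#
    *-cancelʳ-distinct {a} {b} {x} a≉b ax≈bx =
      cancel-factor (a≉b ∘ a-b≈0⇒a≈b) (trans ([y-z]x≈yx-zx x a b) (a≈b⇒a-b≈0 ax≈bx))

    -- Induction on the number of coefficients: after division by X - `ρ zero` the other points are
    -- still roots, because a domain allows cancelling their nonzero difference from `ρ zero`.
    enough-roots⇒≈0 : ∀ {n} (f ρ : Fin n → Carrier) → (∀ {i j} → i ≢ j → ¬ ρ i ≈ ρ j) →
                      (∀ i → eval f (ρ i) ≈ 0#) → ∀ i → f i ≈ 0#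
    enough-roots⇒≈0 {suc n} f ρ distinct roots =
      quot≈0⇒≈0 f r (roots zero)
        (enough-roots⇒≈0 (quot f r) (ρ ∘ suc) (λ i≢j → distinct (i≢j ∘ Fin.suc-injective)) quot-roots)
      where
      r = ρ zero
      quot-roots : ∀ i → eval (quot f r) (ρ (suc i)) ≈ 0#
      quot-roots i = *-cancelʳ-distinct (distinct {zero} {suc i} λ ()) (begin
        r * Q            ≈⟨ +-identityˡ _ ⟨
        0# + r * Q       ≈⟨ +-congʳ (roots (suc i)) ⟨
        eval f x + r * Q ≈⟨ eval-quot f r x ⟩
        eval f r + x * Q ≈⟨ +-congʳ (roots zero) ⟩
        0# + x * Q       ≈⟨ +-identityˡ _ ⟩
        x * Q            ∎)
        where
        x = ρ (suc i)
        Q = eval (quot f r) x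

    -- All coefficients of X^(2+k) - X, in particular the leading one, would vanish.
    fixed-points-bound : ∀ k (ρ : Fin (suc (suc (suc k))) → Carrier) → (∀ {i j} → i ≢ j → ¬ ρ i ≈ ρ j) →
                         (∀ i → ρ i ^ suc (suc k) ≈ ρ i) → ⊥
    fixed-points-bound k ρ distinct fixed =
      1≉0 (trans (sym (monomial-leading k)) (enough-roots⇒≈0 f ρ distinct roots (suc (suc (Fin.fromℕ k)))))
      where
      f : Fin (suc (suc (suc k))) → Carrier
      f zero          = 0#
      f (suc zero)    = - 1#
      f (suc (suc i)) = monomial k i
      roots : ∀ i → eval f (ρ i) ≈ 0#
      roots i = begin
        0# + x * (- 1# + x * eval (monomial k) x) ≈⟨ +-identityˡ _ ⟩
        x * (- 1# + x * eval (monomial k) x)      ≈⟨ *-congˡ (+-congˡ (*-congˡ (eval-monomial k x))) ⟩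
        x * (- 1# + x * x ^ k)                    ≈⟨ distribˡ x _ _ ⟩
        x * - 1# + x ^ suc (suc k)                ≈⟨ +-cong (trans (*-comm x _) (-1*x≈-x x)) (fixed i) ⟩
        - x + x                                   ≈⟨ -‿inverseˡ x ⟩
        0#                                        ∎
        where x = ρ i

-- A planar difference structure on Fin q: line t b y is the line of slope t through (b , y),
-- named by its intercept, as y - t b in a field of order q.
record LineSystem (q : ℕ) : Set where
  field
    line         : (t b y : Fin q) → Fin q
    point        : (t b x : Fin q) → Fin q
    line-point   : ∀ t b x → line t b (point t b x) ≡ x
    point-line   : ∀ t b y → point t b (line t b y) ≡ y
    intersection : ∀ {t t′ b b′ y y′} → t ≢ t′ → line t b y ≡ line t b′ y′ → line t′ b y ≡ line t′ b′ y′ → b ≡ b′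

module FieldOfOrder
  {c ℓ} (K : CommutativeRing c ℓ) (domain : IsDecidableDomain K)
  {p : ℕ} (pp : Prime p) (char : CharacteristicDivides K p)
  where
  open CommutativeRing K hiding (zero)
  open IsDecidableDomain domain
  open Powers K
  open Frobenius K pp char
  open Horner K
  open SetoidReasoning setoid

  -- A Bézout relation between `n` and `p` expresses 1 through multiples of both, and these vanish
  -- in `K`.
  coprime-multiple⇒⊥ : ∀ {n} .{{_ : ℕ.NonZero n}} → n ℕ.< p → n · 1# ≈ 0# → ⊥
  coprime-multiple⇒⊥ {n} n<p n·1≈0 with coprime-Bézout (prime⇒coprime pp n<p)
  ... | Bézout.+- x y eq = 1≉0 (begin
      1#                       ≈⟨ +-identityʳ 1# ⟨
      1# + 0#                  ≈⟨ +-congˡ (trans (×1-homo-* y n) (trans (*-congˡ n·1≈0) (zeroʳ _))) ⟨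
      (1 ℕ.+ y ℕ.* n) · 1#     ≈⟨ ×-congˡ eq ⟩
      (x ℕ.* p) · 1#           ≈⟨ p∣n⇒n·a≈0 (divides x ≡.refl) 1# ⟩
      0#                       ∎)
  ... | Bézout.-+ x y eq = 1≉0 (begin
      1#                       ≈⟨ +-identityʳ 1# ⟨
      1# + 0#                  ≈⟨ +-congˡ (p∣n⇒n·a≈0 (divides x ≡.refl) 1#) ⟨
      (1 ℕ.+ x ℕ.* p) · 1#     ≈⟨ ×-congˡ eq ⟩
      (y ℕ.* n) · 1#           ≈⟨ ×1-homo-* y n ⟩
      (y · 1#) * (n · 1#)      ≈⟨ *-congˡ n·1≈0 ⟩
      (y · 1#) * 0#            ≈⟨ zeroʳ _ ⟩
      0#                       ∎)

  multiples-distinct-< : ∀ {m n} → m ℕ.< n → n ℕ.< p → ¬ m · 1# ≈ n · 1#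
  multiples-distinct-< {m} {n} m<n n<p eq =
    coprime-multiple⇒⊥ {{ℕ.>-nonZero (ℕ.m<n⇒0<n∸m m<n)}} (ℕ.≤-<-trans (ℕ.m∸n≤m n m) n<p)
      (+-cancelˡ (m · 1#) _ _ (begin
        m · 1# + (n ℕ.∸ m) · 1# ≈⟨ ×-homo-+ 1# m (n ℕ.∸ m) ⟨
        (m ℕ.+ (n ℕ.∸ m)) · 1#  ≈⟨ ×-congˡ (ℕ.m+[n∸m]≡n (ℕ.<⇒≤ m<n)) ⟩
        n · 1#                  ≈⟨ eq ⟨
        m · 1#                  ≈⟨ +-identityʳ _ ⟨
        m · 1# + 0#             ∎))

  -- The elements of the prime field, listed without repetition by `digit-injective`.
  digit : Fin p → Carrier
  digit i = toℕ i · 1#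

  digit-injective : ∀ {i j} → digit i ≈ digit j → i ≡ j
  digit-injective {i} {j} eq with Fin.<-cmp i j
  ... | tri< i<j _ _ = ⊥-elim (multiples-distinct-< i<j (Fin.toℕ<n j) eq)
  ... | tri≈ _ i≡j _ = i≡j
  ... | tri> _ _ j<i = ⊥-elim (multiples-distinct-< j<i (Fin.toℕ<n i) (sym eq))

  digit-fixed : ∀ i → digit i ^ p ≈ digit i
  digit-fixed i = frobenius-fix-· (toℕ i) (1^n≈1 p)

  -- The Frobenius map is a ring endomorphism that fixes the coefficients, so it commutes with
  -- evaluation and sends roots to roots.
  eval-frobenius : ∀ {n} (f : Fin n → Carrier) → (∀ i → f i ^ p ≈ f i) → ∀ r → eval f (r ^ p) ≈ eval f r ^ p
  eval-frobenius {zero}  f fixed r = sym frobenius-0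
  eval-frobenius {suc n} f fixed r = begin
    f zero + r ^ p * eval (f ∘ suc) (r ^ p)     ≈⟨ +-cong (sym (fixed zero)) (*-congˡ (eval-frobenius (f ∘ suc) (fixed ∘ suc) r)) ⟩
    f zero ^ p + r ^ p * eval (f ∘ suc) r ^ p   ≈⟨ +-congˡ (^-distrib-* r (eval (f ∘ suc) r) p) ⟨
    f zero ^ p + (r * eval (f ∘ suc) r) ^ p     ≈⟨ frobenius-+ _ _ ⟨
    eval f r ^ p                                ∎

  conjugate-root : ∀ {n} (f : Fin n → Carrier) → (∀ i → f i ^ p ≈ f i) →
                   ∀ r → eval f r ≈ 0# → ∀ i → eval f (r ^ (p ℕ.^ i)) ≈ 0#
  conjugate-root f fixed r root zero    = trans (eval-congʳ f (^-identityʳ r)) root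
  conjugate-root f fixed r root (suc i) = trans (eval-congʳ f (^-p^[1+e] r i))
    (conjugate-root f fixed (r ^ p) (trans (eval-frobenius f fixed r) (trans (^-congˡ p root) frobenius-0)) i)

  module _
    (e : ℕ) (0<e : 0 ℕ.< e)
    (fixed : ∀ a → a ^ (p ℕ.^ e) ≈ a)
    (α : Carrier) (degree : ∀ {d} → 0 ℕ.< d → d ℕ.< e → ¬ α ^ (p ℕ.^ d) ≈ α)
    where

    -- Raising an equality of the conjugates `i` and `j` to the power p^(e - i) turns the left side
    -- into `α` and the right side into α^(p^(j - i)), against `degree`.
    conjugates-distinct-< : ∀ {i j} → i ℕ.< j → j ℕ.< e → ¬ α ^ (p ℕ.^ i) ≈ α ^ (p ℕ.^ j)
    conjugates-distinct-< {i} {j} i<j j<e eq = degree (ℕ.m<n⇒0<n∸m i<j) (ℕ.≤-<-trans (ℕ.m∸n≤m j i) j<e) (begin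
      α ^ (p ℕ.^ d)                               ≈⟨ ^-congˡ (p ℕ.^ d) (fixed α) ⟨
      (α ^ (p ℕ.^ e)) ^ (p ℕ.^ d)                 ≈⟨ merge e d ⟩
      α ^ (p ℕ.^ (e ℕ.+ d))                       ≈⟨ ^-congʳ α (≡.cong (p ℕ.^_) exponent) ⟩
      α ^ (p ℕ.^ (j ℕ.+ (e ℕ.∸ i)))               ≈⟨ merge j (e ℕ.∸ i) ⟨
      (α ^ (p ℕ.^ j)) ^ (p ℕ.^ (e ℕ.∸ i))         ≈⟨ ^-congˡ (p ℕ.^ (e ℕ.∸ i)) eq ⟨
      (α ^ (p ℕ.^ i)) ^ (p ℕ.^ (e ℕ.∸ i))         ≈⟨ merge i (e ℕ.∸ i) ⟩
      α ^ (p ℕ.^ (i ℕ.+ (e ℕ.∸ i)))               ≈⟨ ^-congʳ α (≡.cong (p ℕ.^_) i+[e-i]≡e) ⟩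
      α ^ (p ℕ.^ e)                               ≈⟨ fixed α ⟩
      α                                           ∎)
      where
      d = j ℕ.∸ i
      i+[e-i]≡e : i ℕ.+ (e ℕ.∸ i) ≡ e
      i+[e-i]≡e = ℕ.m+[n∸m]≡n (ℕ.<⇒≤ (ℕ.<-trans i<j j<e))
      merge : ∀ a b → (α ^ (p ℕ.^ a)) ^ (p ℕ.^ b) ≈ α ^ (p ℕ.^ (a ℕ.+ b))
      merge a b = trans (^-assocʳ α (p ℕ.^ a) (p ℕ.^ b)) (^-congʳ α (≡.sym (ℕ.^-distribˡ-+-* p a b)))
      exponent : e ℕ.+ d ≡ j ℕ.+ (e ℕ.∸ i)
      exponent = m+[n∸o]≡n+[m∸o] (ℕ.<⇒≤ (ℕ.<-trans i<j j<e)) (ℕ.<⇒≤ i<j)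

    conjugate : Fin e → Carrier
    conjugate i = α ^ (p ℕ.^ toℕ i)

    conjugates-distinct : ∀ {i j} → i ≢ j → ¬ conjugate i ≈ conjugate j
    conjugates-distinct {i} {j} i≢j eq with Fin.<-cmp i j
    ... | tri< i<j _ _ = conjugates-distinct-< i<j (Fin.toℕ<n j) eq
    ... | tri≈ _ i≡j _ = i≢j i≡j
    ... | tri> _ _ j<i = conjugates-distinct-< j<i (Fin.toℕ<n i) (sym eq)

    -- The `e` base-`p` digits of the index are the coefficients of a polynomial in `α`.
    element : Fin (p ℕ.^ e) → Carrier
    element i = eval (digit ∘ finToFun {p} {e} i) α

    -- The difference of the two digit polynomials vanishes at `α`. Its coefficients are fixed by
    -- Frobenius, so it vanishes at all `e` distinct conjugates, which is too many for `e`
    -- coefficients that are not all zero.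
    element-injective : ∀ {i j} → element i ≈ element j → i ≡ j
    element-injective {i} {j} eq = finToFun-injective {e} {p} i j λ k →
      digit-injective (a-b≈0⇒a≈b (enough-roots⇒≈0 domain f conjugate conjugates-distinct roots k))
      where
      di dj f : Fin e → Carrier
      di = digit ∘ finToFun {p} {e} i
      dj = digit ∘ finToFun {p} {e} j
      f k = di k - dj k
      f+dj≈di : eval f α + eval dj α ≈ eval di α
      f+dj≈di = trans (sym (eval-+ f dj α)) (eval-cong α λ k → [a-b]+b≈a (di k) (dj k))
      roots : ∀ k → eval f (conjugate k) ≈ 0#
      roots k = conjugate-root f (λ k → frobenius-fix-- (digit-fixed (finToFun {p} {e} i k)) (digit-fixed (finToFun {p} {e} j k))) α
        (trans (a+b≈c⇒a≈c-b f+dj≈di) (a≈b⇒a-b≈0 eq)) (toℕ k)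

    -- An element outside the image would give, together with the p^e values of `element`, one root
    -- too many of X^(p^e) - X.
    element-surjective : ∀ a → ∃[ i ] element i ≈ a
    element-surjective a = helper (p ℕ.^ e) (2≤p^e pp 0<e) fixed element element-injective
      where
      -- The order is abstracted so that it can be matched against `suc (suc k)`, the exponent in
      -- `fixed-points-bound`.
      helper : ∀ q → 2 ℕ.≤ q → (∀ a → a ^ q ≈ a) → (g : Fin q → Carrier) →
               (∀ {i j} → g i ≈ g j → i ≡ j) → ∃[ i ] g i ≈ a
      helper (suc zero) (ℕ.s≤s ()) _ _ _
      helper (suc (suc k)) _ fixed g injective with Fin.any? (λ i → g i ≈? a)
      ... | yes found = found
      ... | no ¬found = ⊥-elim (fixed-points-bound domain k ρ distinct (λ i → fixed (ρ i)))
        where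
        ρ : Fin (suc (suc (suc k))) → Carrier
        ρ zero    = a
        ρ (suc i) = g i
        distinct : ∀ {i j} → i ≢ j → ¬ ρ i ≈ ρ j
        distinct {zero}  {zero}  i≢j eq = i≢j ≡.refl
        distinct {zero}  {suc j} i≢j eq = ¬found (j , sym eq)
        distinct {suc i} {zero}  i≢j eq = ¬found (i , eq)
        distinct {suc i} {suc j} i≢j eq = i≢j (≡.cong suc (injective eq))

    index : Carrier → Fin (p ℕ.^ e)
    index a = proj₁ (element-surjective a)

    element-index : ∀ a → element (index a) ≈ a
    element-index a = proj₂ (element-surjective a)

    lineSystem : LineSystem (p ℕ.^ e)
    lineSystem = record
      { line         = λ t b y → index (element y - element t * element b)
      ; point        = λ t b x → index (element x + element t * element b)
      ; line-point   = λ t b x → element-injective (begin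
          element (index (element (index (element x + element t * element b)) - element t * element b))
            ≈⟨ element-index _ ⟩
          element (index (element x + element t * element b)) - element t * element b
            ≈⟨ a+b≈c⇒a≈c-b (sym (element-index _)) ⟨
          element x ∎)
      ; point-line   = λ t b y → element-injective (begin
          element (index (element (index (element y - element t * element b)) + element t * element b))
            ≈⟨ element-index _ ⟩
          element (index (element y - element t * element b)) + element t * element b
            ≈⟨ +-congʳ (element-index _) ⟩
          element y - element t * element b + element t * element b
            ≈⟨ [a-b]+b≈a _ _ ⟩
          element y ∎)
      -- Both slopes satisfy t (b - b′) = y - y′, so `b - b′` is annihilated by the nonzero
      -- difference of the slopes.
      ; intersection = λ {t} {t′} {b} {b′} {y} {y′} t≢t′ l≡l′ m≡m′ →
          element-injective (a-b≈0⇒a≈b (*-cancelʳ-distinct domain (t≢t′ ∘ element-injective)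
            (trans (slope (unindex l≡l′)) (sym (slope (unindex m≡m′))))))
      }
      where
      unindex : ∀ {a b} → index a ≡ index b → a ≈ b
      unindex {a} {b} eq = trans (sym (element-index a)) (trans (reflexive (≡.cong element eq)) (element-index b))
      slope : ∀ {t b b′ y y′} → y - t * b ≈ y′ - t * b′ → t * (b - b′) ≈ y - y′
      slope {t} {b} {b′} {y} {y′} eq = trans (x[y-z]≈xy-xz t b b′) (a+b≈c⇒a≈c-b (+-cancelʳ (- (t * b)) _ _ (begin
        ((t * b - t * b′) + y′) - t * b ≈⟨ solve 4 (λ u v w z → ((u :+ v) :+ w) :+ z := (w :+ v) :+ (u :+ z)) refl (t * b) (- (t * b′)) y′ (- (t * b)) ⟩
        (y′ - t * b′) + (t * b - t * b) ≈⟨ trans (+-congˡ (-‿inverseʳ (t * b))) (+-identityʳ _) ⟩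
        y′ - t * b′                     ≈⟨ eq ⟨
        y - t * b                       ∎)))
        where open NatSolver commutativeSemiring using (solve; _:=_; _:+_)

-- Quotients by idempotents

module IdempotentQuotient {c ℓ} (A : CommutativeRing c ℓ) (u : CommutativeRing.Carrier A) where
  open CommutativeRing A hiding (zero)
  open Powers A
  open SetoidReasoning setoid

  infix 4 _~_
  -- Equality in the quotient of `A` by the annihilator of `u`, which for an idempotent `u` is the
  -- direct factor uA. Carrier and operations stay those of `A`.
  _~_ : Carrier → Carrier → Set ℓ
  a ~ b = u * a ≈ u * b

  ≈⇒~ : ∀ {a b} → a ≈ b → a ~ b
  ≈⇒~ = *-congˡ

  ~-+-cong : ∀ {a a′ b b′} → a ~ a′ → b ~ b′ → a + b ~ a′ + b′
  ~-+-cong a~a′ b~b′ = trans (distribˡ u _ _) (trans (+-cong a~a′ b~b′) (sym (distribˡ u _ _)))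

  ~-*-cong : ∀ {a a′ b b′} → a ~ a′ → b ~ b′ → a * b ~ a′ * b′
  ~-*-cong {a} {a′} {b} {b′} a~a′ b~b′ = begin
    u * (a * b)   ≈⟨ *-assoc u a b ⟨
    (u * a) * b   ≈⟨ *-congʳ a~a′ ⟩
    (u * a′) * b  ≈⟨ *-congʳ (*-comm u a′) ⟩
    (a′ * u) * b  ≈⟨ *-assoc a′ u b ⟩
    a′ * (u * b)  ≈⟨ *-congˡ b~b′ ⟩
    a′ * (u * b′) ≈⟨ *-assoc a′ u b′ ⟨
    (a′ * u) * b′ ≈⟨ *-congʳ (*-comm a′ u) ⟩
    (u * a′) * b′ ≈⟨ *-assoc u a′ b′ ⟩
    u * (a′ * b′) ∎

  quotientRing : CommutativeRing c ℓ
  quotientRing = record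
    { Carrier = Carrier ; _≈_ = _~_ ; _+_ = _+_ ; _*_ = _*_ ; -_ = -_ ; 0# = 0# ; 1# = 1#
    ; isCommutativeRing = record
      { isRing = record
        { +-isAbelianGroup = record
          { isGroup = record
            { isMonoid = record
              { isSemigroup = record
                { isMagma = record
                  { isEquivalence = record { refl = refl ; sym = sym ; trans = trans }
                  ; ∙-cong        = ~-+-cong
                  }
                ; assoc = λ a b c → ≈⇒~ (+-assoc a b c)
                }
              ; identity = (λ a → ≈⇒~ (+-identityˡ a)) , (λ a → ≈⇒~ (+-identityʳ a))
              }
            ; inverse = (λ a → ≈⇒~ (-‿inverseˡ a)) , (λ a → ≈⇒~ (-‿inverseʳ a))
            ; ⁻¹-cong = λ {a} {b} a~b →
                trans (sym (-‿distribʳ-* u a)) (trans (-‿cong a~b) (-‿distribʳ-* u b))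
            }
          ; comm = λ a b → ≈⇒~ (+-comm a b)
          }
        ; *-cong     = ~-*-cong
        ; *-assoc    = λ a b c → ≈⇒~ (*-assoc a b c)
        ; *-identity = (λ a → ≈⇒~ (*-identityˡ a)) , (λ a → ≈⇒~ (*-identityʳ a))
        ; distrib    = (λ a b c → ≈⇒~ (distribˡ a b c)) , (λ a b c → ≈⇒~ (distribʳ a b c))
        }
      ; *-comm = λ a b → ≈⇒~ (*-comm a b)
      }
    }

  private module Q = Powers quotientRing

  -- _·_ and _^_ depend on the raw bundle, hence on the equality, so these are not definitional.
  ·-quotient : ∀ n a → n Q.· a ≡ n · a
  ·-quotient zero    a = ≡.refl
  ·-quotient (suc n) a = ≡.cong (_+_ a) (·-quotient n a)

  ^-quotient : ∀ a n → a Q.^ n ≡ a ^ n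
  ^-quotient a zero    = ≡.refl
  ^-quotient a (suc n) = ≡.cong (a *_) (^-quotient a n)

module MinimalIdempotent
  {c ℓ} (A : CommutativeRing c ℓ) (_≈?_ : ∀ a b → Dec (CommutativeRing._≈_ A a b))
  (k : ℕ) (fixed : ∀ a → CommutativeRing._≈_ A (Powers._^_ A a (suc (suc k))) a)
  where
  open CommutativeRing A hiding (zero)
  open Powers A
  open SetoidReasoning setoid
  private n = suc k

  record NonzeroIdempotent (u : Carrier) : Set ℓ where
    field
      idempotent : u * u ≈ u
      nonzero    : ¬ u ≈ 0#
  open NonzeroIdempotent

  -- `fixed` says that `a ^ n` acts as the identity on `a`, hence on every positive power of `a` and
  -- in particular on itself.
  a≉0⇒a^n : ∀ {a} → ¬ a ≈ 0# → NonzeroIdempotent (a ^ n)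
  a≉0⇒a^n {a} a≉0 = record
    { idempotent = begin
        a ^ n * (a * a ^ k) ≈⟨ *-assoc (a ^ n) a (a ^ k) ⟨
        (a ^ n * a) * a ^ k ≈⟨ *-congʳ (trans (*-comm (a ^ n) a) (fixed a)) ⟩
        a ^ n               ∎
    ; nonzero = λ a^n≈0 → a≉0 (trans (sym (fixed a)) (trans (*-congˡ a^n≈0) (zeroʳ a)))
    }

  -- The idempotent shrinks along the enumeration. If `u` kills `a ^ n`, it kills `a` and is kept;
  -- otherwise it is replaced by `u * a ^ n`, on which `a ^ n` acts as the identity. Either outcome
  -- is inherited by every smaller idempotent, so later steps do not spoil it.
  refine : ∀ {M} (enum : Fin M → Carrier) {u} → NonzeroIdempotent u →
           ∃[ v ] NonzeroIdempotent v × v * u ≈ v × (∀ i → v * enum i ≈ 0# ⊎ v * enum i ^ n ≈ v)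
  refine {zero}  enum {u} u-idem = u , u-idem , idempotent u-idem , λ ()
  refine {suc M} enum {u} u-idem with (u * enum zero ^ n) ≈? 0#
  ... | yes ua^n≈0 =
    let v , v-idem , vu≈v , v-enum = refine (enum ∘ suc) u-idem in
    v , v-idem , vu≈v , λ { zero → inj₁ (kills v vu≈v) ; (suc i) → v-enum i }
    where
    a = enum zero
    ua≈0 : u * a ≈ 0#
    ua≈0 = begin
      u * a           ≈⟨ *-congˡ (fixed a) ⟨
      u * (a * a ^ n) ≈⟨ *-congˡ (*-comm a (a ^ n)) ⟩
      u * (a ^ n * a) ≈⟨ *-assoc u (a ^ n) a ⟨
      u * a ^ n * a   ≈⟨ *-congʳ ua^n≈0 ⟩
      0# * a          ≈⟨ zeroˡ a ⟩
      0#              ∎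
    kills : ∀ v → v * u ≈ v → v * a ≈ 0#
    kills v vu≈v = begin
      v * a       ≈⟨ *-congʳ vu≈v ⟨
      v * u * a   ≈⟨ *-assoc v u a ⟩
      v * (u * a) ≈⟨ *-congˡ ua≈0 ⟩
      v * 0#      ≈⟨ zeroʳ v ⟩
      0#          ∎
  ... | no ua^n≉0 =
    let v , v-idem , vw≈v , v-enum = refine (enum ∘ suc) w-idem in
    v , v-idem , below v vw≈v , λ { zero → inj₂ (fixes v vw≈v) ; (suc i) → v-enum i }
    where
    b w : Carrier
    b = enum zero ^ n
    w = u * b
    bb≈b : b * b ≈ b
    bb≈b = idempotent (a≉0⇒a^n λ a≈0 → ua^n≉0 (trans (*-congˡ (trans (*-congʳ a≈0) (zeroˡ _))) (zeroʳ u)))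
    wb≈w : w * b ≈ w
    wb≈w = trans (*-assoc u b b) (*-congˡ bb≈b)
    wu≈w : w * u ≈ w
    wu≈w = trans (*-comm w u) (trans (sym (*-assoc u u b)) (*-congʳ (idempotent u-idem)))
    w-idem : NonzeroIdempotent w
    w-idem = record { idempotent = trans (sym (*-assoc w u b)) (trans (*-congʳ wu≈w) wb≈w) ; nonzero = ua^n≉0 }
    absorb : ∀ v x → w * x ≈ w → v * w ≈ v → v * x ≈ v
    absorb v x wx≈w vw≈v = trans (*-congʳ (sym vw≈v)) (trans (*-assoc v w x) (trans (*-congˡ wx≈w) vw≈v))
    below : ∀ v → v * w ≈ v → v * u ≈ v
    below v = absorb v u wu≈w
    fixes : ∀ v → v * w ≈ v → v * b ≈ v
    fixes v = absorb v b wb≈w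

  module _ {M} (enum : Fin M → Carrier) (enum-surjective : ∀ a → ∃[ i ] a ≈ enum i)
           {u} (u-idem : NonzeroIdempotent u) (minimal : ∀ i → u * enum i ≈ 0# ⊎ u * enum i ^ n ≈ u) where
    open IdempotentQuotient A u

    -- By minimality an element that is nonzero in the quotient has `n`-th power 1 there, so `a ^ k`
    -- is its inverse.
    quotient-isDecidableDomain : IsDecidableDomain quotientRing
    quotient-isDecidableDomain = record
      { _≈?_          = λ a b → (u * a) ≈? (u * b)
      ; 1≉0           = λ u≈0 → nonzero u-idem (trans (sym (*-identityʳ u)) (trans u≈0 (zeroʳ u)))
      ; cancel-factor = cancel
      }
      where
      cancel : ∀ {a b} → ¬ a ~ 0# → a * b ~ 0# → b ~ 0#
      cancel {a} {b} a≁0 ab~0 with enum-surjective a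
      ... | i , a≈i with minimal i
      ...   | inj₁ ui≈0   = ⊥-elim (a≁0 (trans (*-congˡ a≈i) (trans ui≈0 (sym (zeroʳ u)))))
      ...   | inj₂ ui^n≈u = begin
        u * b                   ≈⟨ *-congʳ (trans (*-congˡ (^-congˡ n a≈i)) ui^n≈u) ⟨
        u * a ^ n * b           ≈⟨ solve 4 (λ u a c b → u :* (a :* c) :* b := c :* (u :* (a :* b))) refl u a (a ^ k) b ⟩
        a ^ k * (u * (a * b))   ≈⟨ *-congˡ (trans ab~0 (zeroʳ u)) ⟩
        a ^ k * 0#              ≈⟨ trans (zeroʳ _) (sym (zeroʳ u)) ⟩
        u * 0#                  ∎
        where open NatSolver commutativeSemiring using (solve; _:=_; _:*_)

module SeparatingQuotient
  {c ℓ} (A : CommutativeRing c ℓ) (dec : ∀ a b → Dec (CommutativeRing._≈_ A a b))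
  {M : ℕ} (enum : Fin M → CommutativeRing.Carrier A) (enum-surjective : ∀ a → ∃[ i ] CommutativeRing._≈_ A a (enum i))
  {p : ℕ} (pp : Prime p) (char : CharacteristicDivides A p)
  {e : ℕ} (0<e : 0 ℕ.< e) (fixed : ∀ a → CommutativeRing._≈_ A (Powers._^_ A a (p ℕ.^ e)) a)
  where
  open CommutativeRing A hiding (zero)
  open Powers A
  open SetoidReasoning setoid

  -- An idempotent below `s ^ n` makes `s` invertible in the quotient. Every α^(p^d) - α with 0 < d
  -- < e divides `s`, so it cannot vanish there.
  separating⇒lineSystem : ∀ α s → ¬ s ≈ 0# →
    (∀ {d} → 0 ℕ.< d → d ℕ.< e → ∃[ h ] s ≈ (α ^ (p ℕ.^ d) - α) * h) → LineSystem (p ℕ.^ e)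
  separating⇒lineSystem α s s≉0 factor =
    FieldOfOrder.lineSystem quotientRing domain pp
      (≈⇒~ (trans (reflexive (·-quotient p 1#)) char)) e 0<e
      (λ a → ≈⇒~ (trans (reflexive (^-quotient a (p ℕ.^ e))) (fixed a))) α
      (λ {d} 0<d d<e α^~α → degree 0<d d<e (trans (≈⇒~ (reflexive (≡.sym (^-quotient α (p ℕ.^ d))))) α^~α))
    where
    -- The subtraction is exact because p^e is at least 2; thus `suc k` is p^e - 1, the exponent
    -- that produces idempotents.
    k = p ℕ.^ e ℕ.∸ 2
    open MinimalIdempotent A dec k
      (λ a → trans (^-congʳ a (ℕ.m+[n∸m]≡n (2≤p^e pp 0<e))) (fixed a))
    s^n-idem = a≉0⇒a^n s≉0
    selected = refine enum s^n-idem
    u = proj₁ selected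
    u-idem = proj₁ (proj₂ selected)
    us^n≈u = proj₁ (proj₂ (proj₂ selected))
    minimal = proj₂ (proj₂ (proj₂ selected))
    open IdempotentQuotient A u
    domain = quotient-isDecidableDomain enum enum-surjective u-idem minimal
    degree : ∀ {d} → 0 ℕ.< d → d ℕ.< e → ¬ α ^ (p ℕ.^ d) ~ α
    degree {d} 0<d d<e α^~α with factor 0<d d<e
    ... | h , s≈ = NonzeroIdempotent.nonzero u-idem (begin
      u                                       ≈⟨ us^n≈u ⟨
      u * (s * s ^ k)                         ≈⟨ *-assoc u s (s ^ k) ⟨
      u * s * s ^ k                           ≈⟨ *-congʳ (*-congˡ s≈) ⟩
      u * ((α ^ (p ℕ.^ d) - α) * h) * s ^ k   ≈⟨ *-congʳ (*-assoc u _ h) ⟨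
      u * (α ^ (p ℕ.^ d) - α) * h * s ^ k     ≈⟨ *-congʳ (*-congʳ (trans (x[y-z]≈xy-xz u _ α) (a≈b⇒a-b≈0 α^~α))) ⟩
      0# * h * s ^ k                          ≈⟨ trans (*-congʳ (zeroˡ h)) (zeroˡ _) ⟩
      0#                                      ∎)

-- Group algebras of cyclic groups

module Sums {c ℓ} (R : CommutativeRing c ℓ) where
  open CommutativeRing R hiding (zero)
  open SemiringSum semiring public

  sum-zero : ∀ {n} {f : Fin n → Carrier} → (∀ i → f i ≈ 0#) → sum f ≈ 0#
  sum-zero {n} f≈0 = trans (sum-cong-≋ f≈0) (sum-replicate-zero n)

  sum-single : ∀ {n} (f : Fin n → Carrier) k → (∀ i → i ≢ k → f i ≈ 0#) → sum f ≈ f k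
  sum-single {suc n} f k f≈0 =
    trans (sum-remove {i = k} f) (trans (+-congˡ (sum-zero λ j → f≈0 _ (Fin.punchInᵢ≢i k j))) (+-identityʳ _))

  δ : ∀ {n} → Fin n → Fin n → Carrier
  δ i j = if does (i Fin.≟ j) then 1# else 0#

  δ-≡ : ∀ {n} {i j : Fin n} → i ≡ j → δ i j ≈ 1#
  δ-≡ {i = i} {j} i≡j rewrite dec-true (i Fin.≟ j) i≡j = refl

  δ-≢ : ∀ {n} {i j : Fin n} → i ≢ j → δ i j ≈ 0#
  δ-≢ {i = i} {j} i≢j rewrite dec-false (i Fin.≟ j) i≢j = refl

  sum-δ : ∀ {n} k (f : Fin n → Carrier) → sum (λ j → δ k j * f j) ≈ f k
  sum-δ k f = trans
    (sum-single _ k λ j j≢k → trans (*-congʳ (δ-≢ (j≢k ∘ ≡.sym))) (zeroˡ _))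
    (trans (*-congʳ (δ-≡ {i = k} ≡.refl)) (*-identityˡ _))

module GroupAlgebra
  {c ℓ} (R : CommutativeRing c ℓ)
  {N} (_∙_ : Fin N → Fin N → Fin N) (ε : Fin N) (_⁻¹ : Fin N → Fin N)
  (isAbelianGroup : IsAbelianGroup _≡_ _∙_ ε _⁻¹)
  where
  open CommutativeRing R hiding (zero)
  open Sums R
  open SetoidReasoning setoid
  private module G = IsAbelianGroup isAbelianGroup

  inverse-cancelˡ : ∀ k j → (k ⁻¹) ∙ (k ∙ j) ≡ j
  inverse-cancelˡ k j = ≡.trans (≡.sym (G.assoc (k ⁻¹) k j)) (≡.trans (≡.cong (_∙ j) (G.inverseˡ k)) (G.identityˡ j))

  inverse-cancelʳ : ∀ k j → k ∙ ((k ⁻¹) ∙ j) ≡ j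
  inverse-cancelʳ k j = ≡.trans (≡.sym (G.assoc k (k ⁻¹) j)) (≡.trans (≡.cong (_∙ j) (G.inverseʳ k)) (G.identityˡ j))

  [j⁻¹∙i]⁻¹∙i≡j : ∀ i j → (((j ⁻¹) ∙ i) ⁻¹) ∙ i ≡ j
  [j⁻¹∙i]⁻¹∙i≡j i j = ≡.trans
    (≡.cong ((l ⁻¹) ∙_) (≡.trans (≡.sym (inverse-cancelʳ j i)) (G.comm j l)))
    (inverse-cancelˡ l j)
    where l = (j ⁻¹) ∙ i

  inverse-∙ : ∀ k l i → ((k ∙ l) ⁻¹) ∙ i ≡ (l ⁻¹) ∙ ((k ⁻¹) ∙ i)
  inverse-∙ k l i = ≡.trans (≡.cong (((k ∙ l) ⁻¹) ∙_) (≡.sym kl∙≡i)) (inverse-cancelˡ (k ∙ l) _)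
    where
    kl∙≡i : (k ∙ l) ∙ ((l ⁻¹) ∙ ((k ⁻¹) ∙ i)) ≡ i
    kl∙≡i = ≡.trans (G.assoc k l _) (≡.trans (≡.cong (k ∙_) (inverse-cancelʳ l _)) (inverse-cancelʳ k i))

  translation : Fin N → Permutation′ N
  translation k = permutation (k ∙_) ((k ⁻¹) ∙_) (inverse-cancelʳ k) (inverse-cancelˡ k)

  -- The involution that exchanges the two factors in a factorisation of `i`; summing along it turns
  -- `f ⋆ g` into `g ⋆ f`.
  reflection : Fin N → Permutation′ N
  reflection i = permutation f f ([j⁻¹∙i]⁻¹∙i≡j i) ([j⁻¹∙i]⁻¹∙i≡j i)
    where
    f : Fin N → Fin N
    f j = (j ⁻¹) ∙ i

  infix  4 _≋_
  infixl 7 _⋆_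
  -- A record rather than bare pointwise equality, so that f and g can be inferred.
  record _≋_ (f g : Fin N → Carrier) : Set ℓ where
    constructor pointwise
    field at : ∀ i → f i ≈ g i
  open _≋_ public

  -- Convolution, with the factorisations of `i` listed by their first factor.
  _⋆_ : (f g : Fin N → Carrier) → Fin N → Carrier
  (f ⋆ g) i = sum λ j → f j * g ((j ⁻¹) ∙ i)

  ⋆-comm : ∀ f g → f ⋆ g ≋ g ⋆ f
  ⋆-comm f g .at i = begin
    sum (λ j → f j * g ((j ⁻¹) ∙ i))
      ≈⟨ sum-permute _ (reflection i) ⟩
    sum (λ j → f ((j ⁻¹) ∙ i) * g ((((j ⁻¹) ∙ i) ⁻¹) ∙ i))
      ≈⟨ sum-cong-≋ (λ j → trans (*-comm _ _) (*-congʳ (reflexive (≡.cong g ([j⁻¹∙i]⁻¹∙i≡j i j))))) ⟩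
    sum (λ j → g j * f ((j ⁻¹) ∙ i)) ∎

  ⋆-assoc : ∀ f g h → (f ⋆ g) ⋆ h ≋ f ⋆ (g ⋆ h)
  ⋆-assoc f g h .at i = begin
    sum (λ j → sum (λ k → f k * g ((k ⁻¹) ∙ j)) * h ((j ⁻¹) ∙ i))
      ≈⟨ sum-cong-≋ (λ j → *-distribʳ-sum (h ((j ⁻¹) ∙ i)) (λ k → f k * g ((k ⁻¹) ∙ j))) ⟩
    sum (λ j → sum λ k → (f k * g ((k ⁻¹) ∙ j)) * h ((j ⁻¹) ∙ i))
      ≈⟨ sum-cong-≋ (λ j → sum-cong-≋ λ k → *-assoc (f k) (g ((k ⁻¹) ∙ j)) (h ((j ⁻¹) ∙ i))) ⟩
    sum (λ j → sum λ k → f k * (g ((k ⁻¹) ∙ j) * h ((j ⁻¹) ∙ i)))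
      ≈⟨ ∑-comm (λ j k → f k * (g ((k ⁻¹) ∙ j) * h ((j ⁻¹) ∙ i))) ⟩
    sum (λ k → sum λ j → f k * (g ((k ⁻¹) ∙ j) * h ((j ⁻¹) ∙ i)))
      ≈⟨ sum-cong-≋ (λ k → *-distribˡ-sum (f k) (λ j → g ((k ⁻¹) ∙ j) * h ((j ⁻¹) ∙ i))) ⟨
    sum (λ k → f k * sum λ j → g ((k ⁻¹) ∙ j) * h ((j ⁻¹) ∙ i))
      ≈⟨ sum-cong-≋ (λ k → *-congˡ (sum-permute (λ j → g ((k ⁻¹) ∙ j) * h ((j ⁻¹) ∙ i)) (translation k))) ⟩
    sum (λ k → f k * sum λ l → g ((k ⁻¹) ∙ (k ∙ l)) * h (((k ∙ l) ⁻¹) ∙ i))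
      ≈⟨ sum-cong-≋ (λ k → *-congˡ (sum-cong-≋ λ l →
           *-cong (reflexive (≡.cong g (inverse-cancelˡ k l))) (reflexive (≡.cong h (inverse-∙ k l i))))) ⟩
    sum (λ k → f k * sum λ l → g l * h ((l ⁻¹) ∙ ((k ⁻¹) ∙ i))) ∎

  δ-⋆ : ∀ k f i → (δ k ⋆ f) i ≈ f ((k ⁻¹) ∙ i)
  δ-⋆ k f i = sum-δ k (λ j → f ((j ⁻¹) ∙ i))

  ⋆-identityˡ : ∀ f → δ ε ⋆ f ≋ f
  ⋆-identityˡ f .at i = trans (δ-⋆ ε f i)
    (reflexive (≡.cong f (≡.trans (≡.cong (_∙ i) (≡.trans (≡.sym (G.identityʳ (ε ⁻¹))) (G.inverseˡ ε))) (G.identityˡ i))))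

  ⋆-cong : ∀ {f f′ g g′} → f ≋ f′ → g ≋ g′ → f ⋆ g ≋ f′ ⋆ g′
  ⋆-cong f≋f′ g≋g′ .at i = sum-cong-≋ λ j → *-cong (f≋f′ .at j) (g≋g′ .at ((j ⁻¹) ∙ i))

  ⋆-distribˡ : ∀ f g h → f ⋆ (λ i → g i + h i) ≋ λ i → (f ⋆ g) i + (f ⋆ h) i
  ⋆-distribˡ f g h .at i = begin
    sum (λ j → f j * (g ((j ⁻¹) ∙ i) + h ((j ⁻¹) ∙ i)))
      ≈⟨ sum-cong-≋ (λ j → distribˡ (f j) (g ((j ⁻¹) ∙ i)) (h ((j ⁻¹) ∙ i))) ⟩
    sum (λ j → f j * g ((j ⁻¹) ∙ i) + f j * h ((j ⁻¹) ∙ i))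
      ≈⟨ ∑-distrib-+ (λ j → f j * g ((j ⁻¹) ∙ i)) (λ j → f j * h ((j ⁻¹) ∙ i)) ⟩
    (f ⋆ g) i + (f ⋆ h) i ∎

  δ-⋆-δ : ∀ k l → δ k ⋆ δ l ≋ δ (k ∙ l)
  δ-⋆-δ k l .at i = trans (δ-⋆ k (δ l) i) (case (l Fin.≟ ((k ⁻¹) ∙ i)) of λ where
    (yes l≡) → trans (δ-≡ l≡) (sym (δ-≡ (≡.trans (≡.cong (k ∙_) l≡) (inverse-cancelʳ k i))))
    (no l≢)  → trans (δ-≢ l≢) (sym (δ-≢ λ kl≡i → l≢ (≡.trans (≡.sym (inverse-cancelˡ k l)) (≡.cong ((k ⁻¹) ∙_) kl≡i)))))

  algebra : CommutativeRing c ℓ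
  algebra = record
    { Carrier = Fin N → Carrier
    ; _≈_ = _≋_
    ; _+_ = λ f g i → f i + g i
    ; _*_ = _⋆_
    ; -_  = λ f i → - f i
    ; 0#  = λ _ → 0#
    ; 1#  = δ ε
    ; isCommutativeRing = record
      { isRing = record
        { +-isAbelianGroup = record
          { isGroup = record
            { isMonoid = record
              { isSemigroup = record
                { isMagma = record
                  { isEquivalence = record
                    { refl  = pointwise λ _ → refl
                    ; sym   = λ f≋g → pointwise λ i → sym (f≋g .at i)
                    ; trans = λ f≋g g≋h → pointwise λ i → trans (f≋g .at i) (g≋h .at i)
                    }
                  ; ∙-cong        = λ f≋f′ g≋g′ → pointwise λ i → +-cong (f≋f′ .at i) (g≋g′ .at i)
                  }
                ; assoc = λ f g h → pointwise λ i → +-assoc (f i) (g i) (h i)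
                }
              ; identity = (λ f → pointwise λ i → +-identityˡ (f i)) , (λ f → pointwise λ i → +-identityʳ (f i))
              }
            ; inverse = (λ f → pointwise λ i → -‿inverseˡ (f i)) , (λ f → pointwise λ i → -‿inverseʳ (f i))
            ; ⁻¹-cong = λ f≋g → pointwise λ i → -‿cong (f≋g .at i)
            }
          ; comm = λ f g → pointwise λ i → +-comm (f i) (g i)
          }
        ; *-cong     = ⋆-cong
        ; *-assoc    = ⋆-assoc
        ; *-identity = ⋆-identityˡ , λ f → pointwise λ i → trans (⋆-comm f (δ ε) .at i) (⋆-identityˡ f .at i)
        ; distrib    = ⋆-distribˡ , λ f g h → pointwise λ i →
            trans (⋆-comm _ f .at i) (trans (⋆-distribˡ f g h .at i) (+-cong (⋆-comm f g .at i) (⋆-comm f h .at i)))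
        }
      ; *-comm = ⋆-comm
      }
    }

  private
    module R = Powers R
    module A = Powers algebra
    module ΣA = Sums algebra

  ·-pointwise : ∀ n f i → (n A.· f) i ≡ n R.· f i
  ·-pointwise zero    f i = ≡.refl
  ·-pointwise (suc n) f i = ≡.cong (_+_ (f i)) (·-pointwise n f i)

  sum-pointwise : ∀ {n} (F : Fin n → Fin N → Carrier) i → ΣA.sum F i ≡ sum (λ j → F j i)
  sum-pointwise {zero}  F i = ≡.refl
  sum-pointwise {suc n} F i = ≡.cong (_+_ (F zero i)) (sum-pointwise (F ∘ suc) i)

  -- When all coefficients are natural multiples of 1, the group elements generate additively; an
  -- additive property then has to be checked on them alone.
  δ-expansion : ∀ f (n : Fin N → ℕ) → (∀ i → f i ≈ n i R.· 1#) → f ≋ ΣA.sum (λ j → n j A.· δ j)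
  δ-expansion f n f≈n .at i = sym (begin
    ΣA.sum (λ j → n j A.· δ j) i  ≡⟨ sum-pointwise (λ j → n j A.· δ j) i ⟩
    sum (λ j → (n j A.· δ j) i)   ≈⟨ sum-single _ i (λ j j≢i → trans (coefficient j) (trans (*-congˡ (δ-≢ j≢i)) (zeroʳ _))) ⟩
    (n i A.· δ i) i               ≈⟨ coefficient i ⟩
    (n i R.· 1#) * δ i i          ≈⟨ trans (*-congˡ (δ-≡ {i = i} ≡.refl)) (*-identityʳ _) ⟩
    n i R.· 1#                    ≈⟨ f≈n i ⟨
    f i                           ∎)
    where
    coefficient : ∀ j → (n j A.· δ j) i ≈ (n j R.· 1#) * δ j i
    coefficient j = trans (reflexive (·-pointwise (n j) (δ j) i)) (sym (R.[n·1]*a≈n·a (n j) (δ j i)))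

-- The cyclic group of order `suc n`

module Cyclic (n : ℕ) where
  private N = suc n

  mod-cong : ∀ {a b} → a % N ≡ b % N → a mod N ≡ b mod N
  mod-cong {a} {b} eq = Fin.toℕ-injective
    (≡.trans (Fin.toℕ-fromℕ< (m%n<n a N)) (≡.trans eq (≡.sym (Fin.toℕ-fromℕ< (m%n<n b N)))))

  toℕ-mod : ∀ a → toℕ (a mod N) ≡ a % N
  toℕ-mod a = Fin.toℕ-fromℕ< (m%n<n a N)

  mod-toℕ : ∀ i → toℕ i mod N ≡ i
  mod-toℕ i = Fin.toℕ-injective (≡.trans (toℕ-mod (toℕ i)) (m<n⇒m%n≡m (Fin.toℕ<n i)))

  _∙_ : Fin N → Fin N → Fin N
  i ∙ j = (toℕ i ℕ.+ toℕ j) mod N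

  -- The reduction modulo `N` acts only at 0, where the difference is `N` itself.
  _⁻¹ : Fin N → Fin N
  i ⁻¹ = (N ℕ.∸ toℕ i) mod N

  mod-∙-mod : ∀ a b → (a mod N) ∙ (b mod N) ≡ (a ℕ.+ b) mod N
  mod-∙-mod a b = mod-cong {toℕ (a mod N) ℕ.+ toℕ (b mod N)} {a ℕ.+ b} (≡.trans
    (≡.cong₂ (λ x y → (x ℕ.+ y) % N) (toℕ-mod a) (toℕ-mod b))
    (≡.sym (%-distribˡ-+ a b N)))

  ∙-comm : ∀ i j → i ∙ j ≡ j ∙ i
  ∙-comm i j = ≡.cong (_mod N) (ℕ.+-comm (toℕ i) (toℕ j))

  ∙-assoc : ∀ i j k → (i ∙ j) ∙ k ≡ i ∙ (j ∙ k)
  ∙-assoc i j k = begin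
    (i ∙ j) ∙ k                               ≡⟨ ≡.cong ((i ∙ j) ∙_) (mod-toℕ k) ⟨
    (i ∙ j) ∙ (toℕ k mod N)                   ≡⟨ mod-∙-mod (toℕ i ℕ.+ toℕ j) (toℕ k) ⟩
    (toℕ i ℕ.+ toℕ j ℕ.+ toℕ k) mod N         ≡⟨ ≡.cong (_mod N) (ℕ.+-assoc (toℕ i) (toℕ j) (toℕ k)) ⟩
    (toℕ i ℕ.+ (toℕ j ℕ.+ toℕ k)) mod N       ≡⟨ mod-∙-mod (toℕ i) (toℕ j ℕ.+ toℕ k) ⟨
    (toℕ i mod N) ∙ (j ∙ k)                   ≡⟨ ≡.cong (_∙ (j ∙ k)) (mod-toℕ i) ⟩
    i ∙ (j ∙ k)                               ∎
    where open ≡.≡-Reasoning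

  ∙-inverseˡ : ∀ i → (i ⁻¹) ∙ i ≡ zero
  ∙-inverseˡ i = begin
    (i ⁻¹) ∙ i                         ≡⟨ ≡.cong ((i ⁻¹) ∙_) (mod-toℕ i) ⟨
    (i ⁻¹) ∙ (toℕ i mod N)             ≡⟨ mod-∙-mod (N ℕ.∸ toℕ i) (toℕ i) ⟩
    (N ℕ.∸ toℕ i ℕ.+ toℕ i) mod N      ≡⟨ ≡.cong (_mod N) (ℕ.m∸n+n≡m (ℕ.<⇒≤ (Fin.toℕ<n i))) ⟩
    N mod N                            ≡⟨ mod-cong {N} {0} (n%n≡0 N) ⟩
    zero                               ∎
    where open ≡.≡-Reasoning

  isAbelianGroup : IsAbelianGroup _≡_ _∙_ zero _⁻¹
  isAbelianGroup = record
    { isGroup = record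
      { isMonoid = record
        { isSemigroup = record
          { isMagma = record { isEquivalence = ≡.isEquivalence ; ∙-cong = ≡.cong₂ _∙_ }
          ; assoc   = ∙-assoc
          }
        ; identity = mod-toℕ , λ i → ≡.trans (∙-comm i zero) (mod-toℕ i)
        }
      ; inverse = ∙-inverseˡ , λ i → ≡.trans (∙-comm i (i ⁻¹)) (∙-inverseˡ i)
      ; ⁻¹-cong = ≡.cong _⁻¹
      }
    ; comm = ∙-comm
    }

-- The integers modulo `p`

module ModularIntegers (p : ℕ) where
  infix 4 _≈_
  record _≈_ (a b : ℤ) : Set where
    constructor congruent
    field difference : + p ℤ.∣ a ℤ.- b
  open _≈_

  private
    ≡⇒≈ : ∀ {a b} → a ≡ b → a ≈ b
    ≡⇒≈ {a} ≡.refl = congruent (≡.subst (+ p ℤ.∣_) (≡.sym (ℤ.+-inverseʳ a)) (ℤ.divides (+ 0) ≡.refl))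

    open ℤ.+-*-Solver

    ≈-via : ∀ {a b c} → c ≡ a ℤ.- b → + p ℤ.∣ c → a ≈ b
    ≈-via eq p∣c = congruent (≡.subst (+ p ℤ.∣_) eq p∣c)

  commutativeRing : CommutativeRing 0ℓ 0ℓ
  commutativeRing = record
    { Carrier = ℤ ; _≈_ = _≈_ ; _+_ = ℤ._+_ ; _*_ = ℤ._*_ ; -_ = ℤ.-_ ; 0# = + 0 ; 1# = + 1
    ; isCommutativeRing = record
      { isRing = record
        { +-isAbelianGroup = record
          { isGroup = record
            { isMonoid = record
              { isSemigroup = record
                { isMagma = record
                  { isEquivalence = record
                    { refl  = λ {a} → ≡⇒≈ {a} ≡.refl
                    ; sym   = λ {a} {b} a≈b → ≈-via (solve 2 (λ a b → :- (a :- b) := b :- a) ≡.refl a b) (ℤ.∣m⇒∣-m (a≈b .difference))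
                    ; trans = λ {a} {b} {c} a≈b b≈c → ≈-via
                        (solve 3 (λ a b c → (a :- b) :+ (b :- c) := a :- c) ≡.refl a b c) (ℤ.∣m∣n⇒∣m+n (a≈b .difference) (b≈c .difference))
                    }
                  ; ∙-cong = λ {a} {a′} {b} {b′} a≈a′ b≈b′ → ≈-via
                      (solve 4 (λ a a′ b b′ → (a :- a′) :+ (b :- b′) := (a :+ b) :- (a′ :+ b′)) ≡.refl a a′ b b′)
                      (ℤ.∣m∣n⇒∣m+n (a≈a′ .difference) (b≈b′ .difference))
                  }
                ; assoc = λ a b c → ≡⇒≈ (ℤ.+-assoc a b c)
                }
              ; identity = (λ a → ≡⇒≈ (ℤ.+-identityˡ a)) , (λ a → ≡⇒≈ (ℤ.+-identityʳ a))
              }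
            ; inverse = (λ a → ≡⇒≈ (ℤ.+-inverseˡ a)) , (λ a → ≡⇒≈ (ℤ.+-inverseʳ a))
            ; ⁻¹-cong = λ {a} {b} a≈b → ≈-via
                (solve 2 (λ a b → :- (a :- b) := (:- a) :- (:- b)) ≡.refl a b) (ℤ.∣m⇒∣-m (a≈b .difference))
            }
          ; comm = λ a b → ≡⇒≈ (ℤ.+-comm a b)
          }
        ; *-cong = λ {a} {a′} {b} {b′} a≈a′ b≈b′ → ≈-via
            (solve 4 (λ a a′ b b′ → (a :- a′) :* b :+ a′ :* (b :- b′) := a :* b :- a′ :* b′) ≡.refl a a′ b b′)
            (ℤ.∣m∣n⇒∣m+n (ℤ.∣m⇒∣m*n b (a≈a′ .difference)) (ℤ.∣n⇒∣m*n a′ (b≈b′ .difference)))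
        ; *-assoc    = λ a b c → ≡⇒≈ (ℤ.*-assoc a b c)
        ; *-identity = (λ a → ≡⇒≈ (ℤ.*-identityˡ a)) , (λ a → ≡⇒≈ (ℤ.*-identityʳ a))
        ; distrib    = (λ a b c → ≡⇒≈ (ℤ.*-distribˡ-+ a b c)) , (λ a b c → ≡⇒≈ (ℤ.*-distribʳ-+ a b c))
        }
      ; *-comm = λ a b → ≡⇒≈ (ℤ.*-comm a b)
      }
    }

  _≈?_ : ∀ a b → Dec (a ≈ b)
  a ≈? b = map′ congruent difference (+ p ℤ.∣? (a ℤ.- b))

  open Powers commutativeRing using (_·_)

  n·1≡n : ∀ n → n · + 1 ≡ + n
  n·1≡n zero    = ≡.refl
  n·1≡n (suc n) = ≡.cong ℤ.suc (n·1≡n n)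

  characteristic : CharacteristicDivides commutativeRing p
  characteristic = congruent
    (≡.subst (+ p ℤ.∣_) (≡.sym (≡.trans (ℤ.+-identityʳ _) (n·1≡n p))) ℤ.∣-refl)

  residue : .{{_ : ℕ.NonZero p}} → ∀ a → ∃[ i ] a ≈ toℕ {p} i · + 1
  residue a = fromℕ< r<p , congruent (ℤ.divides (a ℤ./ℕ p) (≡.trans
    (≡.cong₂ ℤ._-_ (ℤ.a≡a%ℕn+[a/ℕn]*n a p) (≡.trans (n·1≡n _) (≡.cong +_ (Fin.toℕ-fromℕ< r<p))))
    (solve 2 (λ x y → (x :+ y) :- x := y) ≡.refl (+ (a ℤ.%ℕ p)) (a ℤ./ℕ p ℤ.* + p))))
    where r<p = ℤ.n%ℕd<d a p

  1≉0 : 2 ℕ.≤ p → ¬ + 1 ≈ + 0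
  1≉0 2≤p 1≈0 = ℕ.<⇒≱ 2≤p (∣⇒≤ (ℤ.∣⇒∣ᵤ (1≈0 .difference)))

-- The algebra 𝔽_p[x]/(x^N - 1): fixed powers and degrees

module CyclicAlgebra {p} (pp : Prime p) (n : ℕ) where
  private
    N = suc n
    module ℤₚ = ModularIntegers p
    R = ℤₚ.commutativeRing
    module R = CommutativeRing R
    module PR = Powers R
  open Sums R using (δ; δ-≡; δ-≢; sum-δ)
  open Cyclic n
  open GroupAlgebra R _∙_ zero _⁻¹ isAbelianGroup
  A : CommutativeRing 0ℓ 0ℓ
  A = algebra
  open CommutativeRing A hiding (zero)
  open Powers A
  open SetoidReasoning setoid

  characteristic : CharacteristicDivides A p
  characteristic = pointwise λ i → R.trans (R.reflexive (·-pointwise p (δ zero) i))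
    (Frobenius.p∣n⇒n·a≈0 R pp ℤₚ.characteristic (divides 1 (≡.sym (ℕ.+-identityʳ p))) (δ zero i))

  open Frobenius A pp characteristic

  _≋?_ : ∀ f g → Dec (f ≈ g)
  f ≋? g = map′ pointwise at (Fin.all? λ i → f i ℤₚ.≈? g i)

  private instance
    p≢0 : ℕ.NonZero p
    p≢0 = prime⇒nonZero pp

  enum : Fin (p ℕ.^ N) → Carrier
  enum c i = toℕ (finToFun {p} {N} c i) PR.· R.1#

  enum-surjective : ∀ f → ∃[ c ] f ≈ enum c
  enum-surjective f = funToFin r , pointwise λ i → R.trans (proj₂ (ℤₚ.residue (f i)))
    (R.reflexive (≡.cong (λ j → toℕ j PR.· R.1#) (≡.sym (Fin.finToFun-funToFin r i))))
    where
    r : Fin N → Fin p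
    r i = proj₁ (ℤₚ.residue (f i))

  x : Carrier
  x = δ (1 mod N)

  x^a≈δ : ∀ a → x ^ a ≈ δ (a mod N)
  x^a≈δ zero    = refl
  x^a≈δ (suc a) = begin
    x * x ^ a                   ≈⟨ *-congˡ {x} (x^a≈δ a) ⟩
    x * δ (a mod N)             ≈⟨ δ-⋆-δ (1 mod N) (a mod N) ⟩
    δ ((1 mod N) ∙ (a mod N))   ≡⟨ ≡.cong δ (mod-∙-mod 1 a) ⟩
    δ (suc a mod N)             ∎

  x^N≈1 : x ^ N ≈ 1#
  x^N≈1 = trans (x^a≈δ N) (reflexive (≡.cong δ (mod-cong {N} {0} (n%n≡0 N))))

  module _ {e} (q≡p^e : suc N ≡ p ℕ.^ e) where

    Fixed : Carrier → Set
    Fixed a = a ^ (p ℕ.^ e) ≈ a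

    fixed-0 : Fixed 0#
    fixed-0 = iterated-frobenius-0 e

    fixed-+ : ∀ {a b} → Fixed a → Fixed b → Fixed (a + b)
    fixed-+ {a} {b} fix-a fix-b = trans (iterated-frobenius-+ e a b) (+-cong fix-a fix-b)

    fixed-· : ∀ m {a} → Fixed a → Fixed (m · a)
    fixed-· zero        fix = fixed-0
    fixed-· (suc m) {a} fix = fixed-+ {a} {m · a} fix (fixed-· m fix)

    fixed-sum : ∀ {m} (F : Fin m → Carrier) → (∀ i → Fixed (F i)) → Fixed (Sums.sum A F)
    fixed-sum {zero}  F fix = fixed-0
    fixed-sum {suc m} F fix = fixed-+ {F zero} {Sums.sum A (F ∘ suc)} (fix zero) (fixed-sum (F ∘ suc) (fix ∘ suc))

    fixed-x : Fixed x
    fixed-x = begin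
      x ^ (p ℕ.^ e)  ≡⟨ ≡.cong (x ^_) q≡p^e ⟨
      x * x ^ N      ≈⟨ *-congˡ {x} x^N≈1 ⟩
      x * 1#         ≈⟨ *-identityʳ x ⟩
      x              ∎

    fixed-^ : ∀ m {a} → Fixed a → Fixed (a ^ m)
    fixed-^ m {a} fix = begin
      (a ^ m) ^ (p ℕ.^ e)     ≈⟨ ^-assocʳ a m (p ℕ.^ e) ⟩
      a ^ (m ℕ.* p ℕ.^ e)     ≡⟨ ≡.cong (a ^_) (ℕ.*-comm m (p ℕ.^ e)) ⟩
      a ^ (p ℕ.^ e ℕ.* m)     ≈⟨ ^-assocʳ a (p ℕ.^ e) m ⟨
      (a ^ (p ℕ.^ e)) ^ m     ≈⟨ ^-congˡ m fix ⟩
      a ^ m                   ∎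

    -- The map a ↦ a^(p^e) is additive, and it fixes `x` because x^N = 1 with N = p^e - 1. So it
    -- fixes the powers of `x`, which generate the algebra additively.
    fixed : ∀ f → Fixed f
    fixed f = begin
      f ^ (p ℕ.^ e)    ≈⟨ ^-congˡ (p ℕ.^ e) expansion ⟩
      s ^ (p ℕ.^ e)    ≈⟨ fixed-sum (λ i → m i · δ i) (λ i → fixed-· (m i) (fixed-δ i)) ⟩
      s                ≈⟨ expansion ⟨
      f                ∎
      where
      m : Fin N → ℕ
      m i = toℕ (proj₁ (ℤₚ.residue (f i)))
      s = Sums.sum A λ i → m i · δ i
      expansion : f ≈ s
      expansion = δ-expansion f m (λ i → proj₂ (ℤₚ.residue (f i)))
      fixed-δ : ∀ i → Fixed (δ i)
      fixed-δ i = begin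
        δ i ^ (p ℕ.^ e)             ≈⟨ ^-congˡ (p ℕ.^ e) x^i≈δi ⟨
        (x ^ toℕ i) ^ (p ℕ.^ e)     ≈⟨ fixed-^ (toℕ i) fixed-x ⟩
        x ^ toℕ i                   ≈⟨ x^i≈δi ⟩
        δ i                         ∎
        where
        x^i≈δi : x ^ toℕ i ≈ δ i
        x^i≈δi = trans (x^a≈δ (toℕ i)) (reflexive (≡.cong δ (mod-toℕ i)))

  -- This reads off the reduced representative, of degree less than `N`. From `d = N` on the
  -- condition is vacuous, so `separator-monic` holds without a bound, which enters in `monic⇒≉0`.
  Monic : ℕ → Carrier → Set
  Monic d f = (∀ i → toℕ i ≡ d → f i R.≈ R.1#) × (∀ i → d ℕ.< toℕ i → f i R.≈ R.0#)

  -- Only coefficients from `a` upwards are considered, so the exponent does not wrap around and the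
  -- truncated subtraction is exact.
  shift : ∀ a f i → a ℕ.≤ toℕ i → (x ^ a * f) i R.≈ f ((toℕ i ℕ.∸ a) mod N)
  shift a f i a≤i = R.trans (*-congʳ {f} (x^a≈δ a) .at i) (R.trans (δ-⋆ k f i) (R.reflexive (≡.cong f k⁻¹∙i≡j)))
    where
    k = a mod N
    j = (toℕ i ℕ.∸ a) mod N
    k∙j≡i : k ∙ j ≡ i
    k∙j≡i = ≡.trans (mod-∙-mod a (toℕ i ℕ.∸ a)) (≡.trans (≡.cong (_mod N) (ℕ.m+[n∸m]≡n a≤i)) (mod-toℕ i))
    k⁻¹∙i≡j : (k ⁻¹) ∙ i ≡ j
    k⁻¹∙i≡j = ≡.trans (≡.cong ((k ⁻¹) ∙_) (≡.sym k∙j≡i)) (inverse-cancelˡ k j)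

  -- From `a` upwards the coefficient of the product at i is f(i - a) - f(i). At i ≥ a + d the
  -- second term vanishes, since a > 0 makes i exceed `d`; the first is 1 or 0 as claimed.
  monic-step : ∀ {a d f} → 0 ℕ.< a → Monic d f → Monic (a ℕ.+ d) ((x ^ a - 1#) * f)
  monic-step {a} {d} {f} 0<a (leading , vanishing) =
    (λ i i≡a+d → let a+d≤i = ℕ.≤-reflexive (≡.sym i≡a+d) in
      R.trans (coefficient i (ℕ.m+n≤o⇒m≤o a a+d≤i)) (R.trans
        (R.+-cong
          (leading _ (≡.trans (toℕ-shift i) (≡.trans (≡.cong (ℕ._∸ a) i≡a+d) (ℕ.m+n∸m≡n a d))))
          (R.-‿cong (vanishing i (d<a+d a+d≤i))))
        R.refl)) ,
    (λ i a+d<i → let a+d≤i = ℕ.<⇒≤ a+d<i in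
      R.trans (coefficient i (ℕ.m+n≤o⇒m≤o a a+d≤i)) (R.trans
        (R.+-cong
          (vanishing _ (ℕ.<-≤-trans (ℕ.m+n≤o⇒m≤o∸n (suc d) (≡.subst (ℕ._< toℕ i) (ℕ.+-comm a d) a+d<i)) (ℕ.≤-reflexive (≡.sym (toℕ-shift i)))))
          (R.-‿cong (vanishing i (d<a+d a+d≤i))))
        (R.-‿inverseʳ R.0#)))
    where
    d<a+d : ∀ {o} → a ℕ.+ d ℕ.≤ o → d ℕ.< o
    d<a+d = ℕ.≤-trans (ℕ.+-monoˡ-≤ d 0<a)
    toℕ-shift : ∀ i → toℕ ((toℕ i ℕ.∸ a) mod N) ≡ toℕ i ℕ.∸ a
    toℕ-shift i = ≡.trans (toℕ-mod (toℕ i ℕ.∸ a)) (m<n⇒m%n≡m (ℕ.≤-<-trans (ℕ.m∸n≤m (toℕ i) a) (Fin.toℕ<n i)))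
    coefficient : ∀ i → a ℕ.≤ toℕ i → ((x ^ a - 1#) * f) i R.≈ f ((toℕ i ℕ.∸ a) mod N) R.- f i
    coefficient i a≤i = R.trans ([y-z]x≈yx-zx f (x ^ a) 1# .at i)
      (R.+-cong (shift a f i a≤i) (R.-‿cong (*-identityˡ f .at i)))

  -- The product of the x^(p^d′) - x with 0 < d′ ≤ d, each divided by the unit `x`.
  separator : ℕ → Carrier
  separator zero    = 1#
  separator (suc d) = (x ^ (p ℕ.^ suc d ℕ.∸ 1) - 1#) * separator d

  degree : ℕ → ℕ
  degree zero    = 0
  degree (suc d) = (p ℕ.^ suc d ℕ.∸ 1) ℕ.+ degree d

  2≤p : 2 ℕ.≤ p
  2≤p = ℕ.nonTrivial⇒n>1 p {{prime⇒nonTrivial pp}}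

  1≤p^d : ∀ d → 1 ℕ.≤ p ℕ.^ d
  1≤p^d d = ℕ.m^n>0 p d

  separator-monic : ∀ d → Monic (degree d) (separator d)
  separator-monic zero    =
    (λ i i≡0 → δ-≡ {i = zero} {j = i} (Fin.toℕ-injective (≡.sym i≡0))) ,
    (λ i 0<i → δ-≢ {i = zero} {j = i} λ { ≡.refl → ℕ.n≮0 0<i })
  separator-monic (suc d) = monic-step {f = separator d} (ℕ.m<n⇒0<n∸m (2≤p^e pp (ℕ.s≤s {0} {d} ℕ.z≤n))) (separator-monic d)

  -- Each step adds at most `Q` to a bound `Q`, and 2Q ≤ pQ. The summand 2 keeps the degree strictly
  -- below p^(d + 1) - 1, the order of the group.
  degree-bound : ∀ d → degree d ℕ.+ 2 ℕ.≤ p ℕ.^ suc d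
  degree-bound zero    = ℕ.≤-trans 2≤p (ℕ.≤-reflexive (≡.sym (ℕ.*-identityʳ p)))
  degree-bound (suc d) = begin′
    (Q ℕ.∸ 1) ℕ.+ degree d ℕ.+ 2    ≤⟨ ℕ.≤-reflexive (ℕ.+-assoc (Q ℕ.∸ 1) (degree d) 2) ⟩
    (Q ℕ.∸ 1) ℕ.+ (degree d ℕ.+ 2)  ≤⟨ ℕ.+-mono-≤ (ℕ.m∸n≤m Q 1) (degree-bound d) ⟩
    Q ℕ.+ Q                         ≤⟨ ℕ.≤-reflexive (≡.cong (Q ℕ.+_) (≡.sym (ℕ.+-identityʳ Q))) ⟩
    2 ℕ.* Q                         ≤⟨ ℕ.*-monoˡ-≤ Q 2≤p ⟩
    p ℕ.* Q                         ∎′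
    where
    open ℕ.≤-Reasoning using (step-≤) renaming (begin_ to begin′_; _∎ to _∎′)
    Q = p ℕ.^ suc d

  monic⇒≉0 : ∀ {d f} → d ℕ.< N → Monic d f → ¬ f ≈ 0#
  monic⇒≉0 {d} d<N (leading , _) f≈0 =
    ℤₚ.1≉0 2≤p (R.trans (R.sym (leading i (Fin.toℕ-fromℕ< d<N))) (f≈0 .at i))
    where i = fromℕ< d<N

  -- As x^N = 1, the inverse of `x` is `x ^ n`; each factor of the separator is therefore x^(p^d′) -
  -- x times `x ^ n`, and the remaining factors join the cofactor.
  separator-factor : ∀ {d d′} → 0 ℕ.< d′ → d′ ℕ.≤ d → ∃[ h ] separator d ≈ (x ^ (p ℕ.^ d′) - x) * h
  separator-factor {zero}  0<d′ d′≤d = ⊥-elim (ℕ.<⇒≱ 0<d′ d′≤d)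
  separator-factor {suc d} {d′} 0<d′ d′≤d with ℕ.m≤n⇒m<n∨m≡n d′≤d
  ... | inj₁ (ℕ.s≤s d′≤d-1) =
    let h , eq = separator-factor {d} 0<d′ d′≤d-1 in
    c * h , (begin
      c * separator d                   ≈⟨ *-congˡ {c} eq ⟩
      c * ((x ^ (p ℕ.^ d′) - x) * h)    ≈⟨ x∙yz≈y∙xz c (x ^ (p ℕ.^ d′) - x) h ⟩
      (x ^ (p ℕ.^ d′) - x) * (c * h)    ∎)
    where
    c = x ^ (p ℕ.^ suc d ℕ.∸ 1) - 1#
    open CommutativeSemigroup *-commutativeSemigroup using (x∙yz≈y∙xz)
  ... | inj₂ ≡.refl = x ^ n * separator d , (begin
    (x ^ a - 1#) * separator d                     ≈⟨ *-congʳ {separator d} (unit-multiple a) ⟩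
    (x ^ suc a - x) * x ^ n * separator d          ≈⟨ *-assoc (x ^ suc a - x) (x ^ n) (separator d) ⟩
    (x ^ suc a - x) * (x ^ n * separator d)        ≡⟨ ≡.cong (λ m → (x ^ m - x) * (x ^ n * separator d)) (ℕ.m+[n∸m]≡n (1≤p^d (suc d))) ⟩
    (x ^ (p ℕ.^ suc d) - x) * (x ^ n * separator d) ∎)
    where
    a = p ℕ.^ suc d ℕ.∸ 1
    unit-multiple : ∀ a → x ^ a - 1# ≈ (x ^ suc a - x) * x ^ n
    unit-multiple a = begin
      x ^ a - 1#                     ≈⟨ *-identityʳ (x ^ a - 1#) ⟨
      (x ^ a - 1#) * 1#              ≈⟨ *-congˡ {x ^ a - 1#} x^N≈1 ⟨
      (x ^ a - 1#) * (x * x ^ n)     ≈⟨ *-assoc (x ^ a - 1#) x (x ^ n) ⟨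
      (x ^ a - 1#) * x * x ^ n       ≈⟨ *-congʳ {x ^ n} (*-comm (x ^ a - 1#) x) ⟩
      x * (x ^ a - 1#) * x ^ n       ≈⟨ *-congʳ {x ^ n} (x[y-z]≈xy-xz x (x ^ a) 1#) ⟩
      (x ^ suc a - x * 1#) * x ^ n   ≈⟨ *-congʳ {x ^ n} (+-congˡ {x ^ suc a} (-‿cong (*-identityʳ x))) ⟩
      (x ^ suc a - x) * x ^ n        ∎

prime-power-lineSystem : ∀ {p} e → Prime p → 0 ℕ.< e → LineSystem (p ℕ.^ e)
prime-power-lineSystem {p} (suc d) pp 0<e =
  SeparatingQuotient.separating⇒lineSystem A _≋?_ enum enum-surjective pp characteristic 0<e
    (fixed {suc d} q≡p^e) x (separator d)
    (monic⇒≉0 {f = separator d} degree<N (separator-monic d))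
    (λ 0<d′ d′<e → separator-factor {d} 0<d′ (ℕ.s≤s⁻¹ d′<e))
  where
  -- Chosen so that the cyclic group, of order `suc n`, has order q - 1 for q = p^(d + 1).
  n = p ℕ.^ suc d ℕ.∸ 2
  open CyclicAlgebra pp n
  q≡p^e : suc (suc n) ≡ p ℕ.^ suc d
  q≡p^e = ℕ.m+[n∸m]≡n (2≤p^e pp (ℕ.s≤s {0} {d} ℕ.z≤n))
  degree<N : degree d ℕ.< suc n
  degree<N = ℕ.s≤s⁻¹ (ℕ.≤-trans (ℕ.≤-reflexive (ℕ.+-comm 2 (degree d)))
    (ℕ.≤-trans (degree-bound d) (ℕ.≤-reflexive (≡.sym q≡p^e))))

-- Matrices and nets

module MatrixAlgebra {c ℓ} (R : CommutativeRing c ℓ) where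
  open CommutativeRing R hiding (zero)
  open Matrices R public
  open Sums R
  open SetoidReasoning setoid

  -- For sums over points that are supported on the intersection of two lines: at most one term
  -- survives, so entries of matrix products are single products.
  sum-at-most-one : ∀ {n} (f : Fin n → Carrier) {Q : Fin n → Set} → (∀ i → Dec (Q i)) →
                    (∀ {i j} → Q i → Q j → i ≡ j) → (∀ i → ¬ Q i → f i ≈ 0#) →
                    sum f ≈ 0# ⊎ (∃[ i ] Q i × sum f ≈ f i)
  sum-at-most-one f Q? unique f≈0 with Fin.any? Q?
  ... | no ¬∃Q       = inj₁ (sum-zero λ i → f≈0 i λ Qi → ¬∃Q (i , Qi))
  ... | yes (i , Qi) = inj₂ (i , Qi , sum-single f i λ j j≢i → f≈0 j λ Qj → j≢i (unique Qj Qi))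

  sum-++ : ∀ k {l} (f : Fin (k ℕ.+ l) → Carrier) → sum f ≈ sum (λ i → f (i Fin.↑ˡ l)) + sum (λ j → f (k Fin.↑ʳ j))
  sum-++ zero    f = sym (+-identityˡ _)
  sum-++ (suc k) f = trans (+-congˡ (sum-++ k (f ∘ suc))) (sym (+-assoc _ _ _))

  sum-combine : ∀ {m} n (f : Fin (m ℕ.* n) → Carrier) → sum f ≈ sum {m} λ i → sum {n} λ j → f (combine i j)
  sum-combine {zero}  n f = refl
  sum-combine {suc m} n f = trans (sum-++ n f) (+-congˡ (sum-combine {m} n (λ j → f (n Fin.↑ʳ j))))

  𝕀-sym : ∀ {n} (i j : Fin n) → 𝕀 i j ≈ 𝕀 j i
  𝕀-sym i j with i Fin.≟ j
  ... | yes i≡j = sym (δ-≡ (≡.sym i≡j))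
  ... | no  i≢j = sym (δ-≢ (i≢j ∘ ≡.sym))

  private variable
    m n o p : ℕ

  ⊗-cong : {A A′ : Matrix m n} {B B′ : Matrix n o} → A ≋ A′ → B ≋ B′ → A ⊗ B ≋ A′ ⊗ B′
  ⊗-cong A≋A′ B≋B′ i j = sum-cong-≋ λ l → *-cong (A≋A′ i l) (B≋B′ l j)

  ⊗-assoc : (A : Matrix m n) (B : Matrix n o) (C : Matrix o p) → (A ⊗ B) ⊗ C ≋ A ⊗ (B ⊗ C)
  ⊗-assoc A B C i j = begin
    sum (λ l → sum (λ k → A i k * B k l) * C l j)
      ≈⟨ sum-cong-≋ (λ l → *-distribʳ-sum (C l j) (λ k → A i k * B k l)) ⟩
    sum (λ l → sum λ k → A i k * B k l * C l j)
      ≈⟨ sum-cong-≋ (λ l → sum-cong-≋ λ k → *-assoc (A i k) (B k l) (C l j)) ⟩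
    sum (λ l → sum λ k → A i k * (B k l * C l j))
      ≈⟨ ∑-comm (λ l k → A i k * (B k l * C l j)) ⟩
    sum (λ k → sum λ l → A i k * (B k l * C l j))
      ≈⟨ sum-cong-≋ (λ k → *-distribˡ-sum (A i k) (λ l → B k l * C l j)) ⟨
    sum (λ k → A i k * sum λ l → B k l * C l j) ∎

  ᵀ-⊗ : (A : Matrix m n) (B : Matrix n o) → (A ⊗ B) ᵀ ≋ B ᵀ ⊗ A ᵀ
  ᵀ-⊗ A B i j = sum-cong-≋ λ l → *-comm (A j l) (B l i)

  scalar-⊗ : ∀ x (A : Matrix m n) → (x • 𝕀) ⊗ A ≋ x • A
  scalar-⊗ x A i j = begin
    sum (λ l → (x * 𝕀 i l) * A l j)  ≈⟨ sum-cong-≋ (λ l → *-assoc x (𝕀 i l) (A l j)) ⟩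
    sum (λ l → x * (𝕀 i l * A l j))  ≈⟨ *-distribˡ-sum x (λ l → 𝕀 i l * A l j) ⟨
    x * sum (λ l → 𝕀 i l * A l j)    ≈⟨ *-congˡ (sum-δ i (λ l → A l j)) ⟩
    x * A i j                        ∎

  ⊗-• : ∀ (A : Matrix m n) x (B : Matrix n o) → A ⊗ (x • B) ≋ x • (A ⊗ B)
  ⊗-• A x B i j = begin
    sum (λ l → A i l * (x * B l j))   ≈⟨ sum-cong-≋ (λ l → x∙yz≈y∙xz (A i l) x (B l j)) ⟩
    sum (λ l → x * (A i l * B l j))   ≈⟨ *-distribˡ-sum x (λ l → A i l * B l j) ⟨
    x * sum (λ l → A i l * B l j)     ∎
    where open CommutativeSemigroup *-commutativeSemigroup using (x∙yz≈y∙xz)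

  -- The product regroups as L (M Mᵀ) L′ᵀ, whose middle factor is a scalar.
  gram-⊗ : ∀ {x} (L L′ : Matrix m n) {M : Matrix n o} → M ⊗ M ᵀ ≋ x • 𝕀 →
           (L ⊗ M) ⊗ (L′ ⊗ M) ᵀ ≋ x • (L ⊗ L′ ᵀ)
  gram-⊗ {x = x} L L′ {M} MMᵀ i j = begin
    ((L ⊗ M) ⊗ (L′ ⊗ M) ᵀ) i j      ≈⟨ ⊗-cong {A = L ⊗ M} (λ _ _ → refl) (ᵀ-⊗ L′ M) i j ⟩
    ((L ⊗ M) ⊗ (M ᵀ ⊗ L′ ᵀ)) i j    ≈⟨ ⊗-assoc L M (M ᵀ ⊗ L′ ᵀ) i j ⟩
    (L ⊗ (M ⊗ (M ᵀ ⊗ L′ ᵀ))) i j    ≈⟨ ⊗-cong {A = L} (λ _ _ → refl) inner i j ⟩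
    (L ⊗ (x • L′ ᵀ)) i j            ≈⟨ ⊗-• L x (L′ ᵀ) i j ⟩
    (x • (L ⊗ L′ ᵀ)) i j            ∎
    where
    inner : M ⊗ (M ᵀ ⊗ L′ ᵀ) ≋ x • L′ ᵀ
    inner k l = begin
      (M ⊗ (M ᵀ ⊗ L′ ᵀ)) k l    ≈⟨ ⊗-assoc M (M ᵀ) (L′ ᵀ) k l ⟨
      ((M ⊗ M ᵀ) ⊗ L′ ᵀ) k l    ≈⟨ ⊗-cong {B = L′ ᵀ} MMᵀ (λ _ _ → refl) k l ⟩
      ((x • 𝕀) ⊗ L′ ᵀ) k l      ≈⟨ scalar-⊗ x (L′ ᵀ) k l ⟩
      (x • L′ ᵀ) k l            ∎

  -- The Kronecker product A ⊗ 𝕀_q, on indices split by remQuot.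
  inflate : ∀ q → Matrix m m → Matrix (m ℕ.* q) (m ℕ.* q)
  inflate {m} q A r r′ = A (quotient {m} q r) (quotient {m} q r′) * 𝕀 (remainder {m} q r) (remainder {m} q r′)

  -- The sum over an index pair (b , y) factors: the identity block collapses the sum over y, and
  -- the sum over b is an entry of A Aᵀ.
  inflate-gram : ∀ q {x} {A : Matrix m m} → A ⊗ A ᵀ ≋ x • 𝕀 → inflate q A ⊗ inflate q A ᵀ ≋ x • 𝕀
  inflate-gram {m} q {x} {A} AAᵀ r r′ = begin
    sum (λ s → inflate q A r s * inflate q A r′ s)
      ≈⟨ sum-combine {m} q (λ s → inflate q A r s * inflate q A r′ s) ⟩
    sum {m} (λ b → sum {q} λ y → inflate q A r (combine b y) * inflate q A r′ (combine b y))
      ≈⟨ sum-cong-≋ (λ b → sum-cong-≋ λ y → reflexive (≡.cong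
           (λ by → (A a (proj₁ by) * 𝕀 i (proj₂ by)) * (A a′ (proj₁ by) * 𝕀 i′ (proj₂ by)))
           (Fin.remQuot-combine {m} {q} b y))) ⟩
    sum (λ b → sum λ y → (A a b * 𝕀 i y) * (A a′ b * 𝕀 i′ y))
      ≈⟨ sum-cong-≋ (λ b → collapse (A a b) (A a′ b)) ⟩
    sum (λ b → A a b * A a′ b * 𝕀 i i′)
      ≈⟨ *-distribʳ-sum (𝕀 i i′) (λ b → A a b * A a′ b) ⟨
    sum (λ b → A a b * A a′ b) * 𝕀 i i′
      ≈⟨ *-congʳ (AAᵀ a a′) ⟩
    x * 𝕀 a a′ * 𝕀 i i′
      ≈⟨ *-assoc x (𝕀 a a′) (𝕀 i i′) ⟩
    x * (𝕀 a a′ * 𝕀 i i′)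
      ≈⟨ *-congˡ 𝕀-split ⟩
    x * 𝕀 r r′ ∎
    where
    a  = quotient {m} q r
    a′ = quotient {m} q r′
    i  = remainder {m} q r
    i′ = remainder {m} q r′
    collapse : ∀ v w → sum (λ y → (v * 𝕀 i y) * (w * 𝕀 i′ y)) ≈ v * w * 𝕀 i i′
    collapse v w = begin
      sum (λ y → (v * 𝕀 i y) * (w * 𝕀 i′ y))
        ≈⟨ sum-cong-≋ (λ y → solve 4 (λ v w s t → (v :* s) :* (w :* t) := s :* (v :* w :* t)) refl v w (𝕀 i y) (𝕀 i′ y)) ⟩
      sum (λ y → 𝕀 i y * (v * w * 𝕀 i′ y))
        ≈⟨ sum-δ i (λ y → v * w * 𝕀 i′ y) ⟩
      v * w * 𝕀 i′ i
        ≈⟨ *-congˡ (𝕀-sym i′ i) ⟩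
      v * w * 𝕀 i i′ ∎
      where open NatSolver commutativeSemiring using (solve; _:=_; _:*_)
    𝕀-split : 𝕀 a a′ * 𝕀 i i′ ≈ 𝕀 r r′
    𝕀-split with r Fin.≟ r′
    ... | yes ≡.refl = trans (*-cong (δ-≡ {i = a} ≡.refl) (δ-≡ {i = i} ≡.refl)) (*-identityˡ 1#)
    ... | no r≢r′ with a Fin.≟ a′
    ...   | no  _    = zeroˡ _
    ...   | yes a≡a′ = trans (*-identityˡ _) (δ-≢ λ i≡i′ → r≢r′ (≡.trans
            (≡.sym (Fin.combine-remQuot {m} q r))
            (≡.trans (≡.cong₂ combine a≡a′ i≡i′) (Fin.combine-remQuot {m} q r′))))

  permute-columns-gram : ∀ {x} (A : Matrix m n) (π : Permutation′ n) → A ⊗ A ᵀ ≋ x • 𝕀 →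
                         (λ i j → A i (π ⟨$⟩ʳ j)) ⊗ (λ i j → A i (π ⟨$⟩ʳ j)) ᵀ ≋ x • 𝕀
  permute-columns-gram A π AAᵀ i j = trans (sym (sum-permute (λ l → A i l * A j l) π)) (AAᵀ i j)

  permute-rows-gram : ∀ {x} (A : Matrix m n) (π : Permutation′ m) → A ⊗ A ᵀ ≋ x • 𝕀 →
                      (λ i j → A (π ⟨$⟩ʳ i) j) ⊗ (λ i j → A (π ⟨$⟩ʳ i) j) ᵀ ≋ x • 𝕀
  permute-rows-gram A π AAᵀ i j = trans (AAᵀ (π ⟨$⟩ʳ i) (π ⟨$⟩ʳ j)) (*-congˡ 𝕀-π)
    where
    𝕀-π : 𝕀 (π ⟨$⟩ʳ i) (π ⟨$⟩ʳ j) ≈ 𝕀 i j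
    𝕀-π with i Fin.≟ j
    ... | yes i≡j = δ-≡ (≡.cong (π ⟨$⟩ʳ_) i≡j)
    ... | no  i≢j = δ-≢ λ πi≡πj → i≢j (≡.trans (≡.sym (inverseˡ π)) (≡.trans (≡.cong (π ⟨$⟩ˡ_) πi≡πj) (inverseˡ π)))

-- m + 1 parallel classes of q lines each, on m q points: π t sends a point to its position
-- on its line of class t (the quotient) and to the name of that line (the remainder).
record Net (m q : ℕ) : Set where
  field
    π : Fin (suc m) → Permutation′ (m ℕ.* q)

  line : Fin (suc m) → Fin (m ℕ.* q) → Fin q
  line t x = remainder {m} q (π t ⟨$⟩ʳ x)

  field
    meet-once : ∀ {s t} → s ≢ t → ∀ {x y} → line s x ≡ line s y → line t x ≡ line t y → x ≡ y

-- Nets from line systems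

module _ {q : ℕ} (lines : LineSystem q) where
  open LineSystem lines renaming (line to lineThrough)

  module Slopes {m} (ι : Fin m → Fin q) (ι-injective : ∀ {b b′} → ι b ≡ ι b′ → b ≡ b′) where

    abscissa : Fin (m ℕ.* q) → Fin m
    abscissa = quotient {m} q

    ordinate : Fin (m ℕ.* q) → Fin q
    ordinate = remainder {m} q

    fibrewise : (Fin m → Fin q → Fin q) → Fin (m ℕ.* q) → Fin (m ℕ.* q)
    fibrewise f x = combine (abscissa x) (f (abscissa x) (ordinate x))

    fibrewise-inverse : ∀ {f g} → (∀ b y → f b (g b y) ≡ y) → ∀ x → fibrewise f (fibrewise g x) ≡ x
    fibrewise-inverse {f} {g} fg≡id x = ≡.trans
      (≡.cong (λ by → combine (proj₁ by) (f (proj₁ by) (proj₂ by))) (Fin.remQuot-combine {m} {q} _ _))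
      (≡.trans (≡.cong (combine (abscissa x)) (fg≡id _ _)) (Fin.combine-remQuot {m} q x))

    -- A line of slope `t` has one point over each abscissa, so the abscissa is kept as the position
    -- on the line and only the ordinate is replaced, by the name of the line.
    slope : Fin q → Permutation′ (m ℕ.* q)
    slope t = permutation (fibrewise λ b → lineThrough t (ι b)) (fibrewise λ b → point t (ι b))
      (fibrewise-inverse {λ b → lineThrough t (ι b)} λ b → line-point t (ι b))
      (fibrewise-inverse {λ b → point t (ι b)} λ b → point-line t (ι b))

    slope-line : ∀ t x → remainder {m} q (slope t ⟨$⟩ʳ x) ≡ lineThrough t (ι (abscissa x)) (ordinate x)
    slope-line t x = ≡.cong proj₂ (Fin.remQuot-combine {m} {q} _ _)

    -- `point` recovers the ordinate from the abscissa and the line.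
    same-abscissa : ∀ t {x y} → abscissa x ≡ abscissa y →
                    remainder {m} q (slope t ⟨$⟩ʳ x) ≡ remainder {m} q (slope t ⟨$⟩ʳ y) → x ≡ y
    same-abscissa t {x} {y} b≡b′ eq = ≡.trans (≡.sym (Fin.combine-remQuot {m} q x))
      (≡.trans (≡.cong₂ combine b≡b′ ordinates) (Fin.combine-remQuot {m} q y))
      where
      ordinates : ordinate x ≡ ordinate y
      ordinates = ≡.trans (≡.sym (point-line t (ι (abscissa x)) (ordinate x)))
        (≡.trans (≡.cong₂ (λ b → point t (ι b)) b≡b′ (≡.trans (≡.sym (slope-line t x)) (≡.trans eq (slope-line t y))))
                 (point-line t (ι (abscissa y)) (ordinate y)))

    slopes-meet-once : ∀ {s t} → s ≢ t → ∀ {x y} →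
                       remainder {m} q (slope s ⟨$⟩ʳ x) ≡ remainder {m} q (slope s ⟨$⟩ʳ y) →
                       remainder {m} q (slope t ⟨$⟩ʳ x) ≡ remainder {m} q (slope t ⟨$⟩ʳ y) → x ≡ y
    slopes-meet-once {s} {t} s≢t {x} {y} eqₛ eqₜ = same-abscissa t (ι-injective (intersection s≢t (via s eqₛ) (via t eqₜ))) eqₜ
      where
      via : ∀ r → remainder {m} q (slope r ⟨$⟩ʳ x) ≡ remainder {m} q (slope r ⟨$⟩ʳ y) →
            lineThrough r (ι (abscissa x)) (ordinate x) ≡ lineThrough r (ι (abscissa y)) (ordinate y)
      via r eq = ≡.trans (≡.sym (slope-line r x)) (≡.trans eq (slope-line r y))

  -- For m = q the q slopes are one class short, and the vertical lines, which have q points, provide it.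
  net : ∀ {m} → m ℕ.≤ q → Net m q
  net {m} m≤q with ℕ.m≤n⇒m<n∨m≡n m≤q
  ... | inj₁ m<q = record
    -- `m<q` is `suc m ≤ q`, so it embeds the m + 1 class indices into the slopes.
    { π         = λ t → slope (inject≤ t m<q)
    ; meet-once = λ s≢t → slopes-meet-once (s≢t ∘ Fin.inject≤-injective m<q m<q _ _)
    }
    where open Slopes {m} (λ b → inject≤ b m≤q) (Fin.inject≤-injective m≤q m≤q _ _)
  ... | inj₂ ≡.refl = record
    { π         = class
    ; meet-once = classes-meet-once
    }
    where
    open Slopes {q} id id
    -- Exchanging coordinates makes the ordinate the position on a vertical line and the abscissa
    -- its name.
    swap : Fin (q ℕ.* q) → Fin (q ℕ.* q)
    swap x = combine (ordinate x) (abscissa x)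
    remQuot-swap : ∀ x → remQuot {q} q (swap x) ≡ (ordinate x , abscissa x)
    remQuot-swap x = Fin.remQuot-combine (ordinate x) (abscissa x)
    swap-swap : ∀ x → swap (swap x) ≡ x
    swap-swap x = ≡.trans (≡.cong (λ by → combine (proj₂ by) (proj₁ by)) (remQuot-swap x)) (Fin.combine-remQuot {q} q x)
    class : Fin (suc q) → Permutation′ (q ℕ.* q)
    class zero    = permutation swap swap swap-swap swap-swap
    class (suc t) = slope t
    abscissae : ∀ {x y} → remainder {q} q (swap x) ≡ remainder {q} q (swap y) → abscissa x ≡ abscissa y
    abscissae {x} {y} eq = ≡.trans (≡.sym (≡.cong proj₂ (remQuot-swap x))) (≡.trans eq (≡.cong proj₂ (remQuot-swap y)))
    classes-meet-once : ∀ {s t} → s ≢ t → ∀ {x y} →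
                        remainder {q} q (class s ⟨$⟩ʳ x) ≡ remainder {q} q (class s ⟨$⟩ʳ y) →
                        remainder {q} q (class t ⟨$⟩ʳ x) ≡ remainder {q} q (class t ⟨$⟩ʳ y) → x ≡ y
    classes-meet-once {zero}  {zero}  s≢t _   _   = ⊥-elim (s≢t ≡.refl)
    classes-meet-once {zero}  {suc t} _   eqₛ eqₜ = same-abscissa t (abscissae eqₛ) eqₜ
    classes-meet-once {suc s} {zero}  _   eqₛ eqₜ = same-abscissa s (abscissae eqₜ) eqₛ
    classes-meet-once {suc s} {suc t} s≢t eqₛ eqₜ = slopes-meet-once (s≢t ∘ ≡.cong suc) eqₛ eqₜ

-- Rational arithmetic and Gram matrices

ℚ-ring : CommutativeRing 0ℓ 0ℓ
ℚ-ring = ℚ.+-*-commutativeRing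

module _ {a b c d} (A : Semiring a b) (B : Semiring c d) where
  private
    module A = Semiring A
    module B = Semiring B

  sum-homo : (h : A.Carrier → B.Carrier) → h A.0# B.≈ B.0# → (∀ x y → h (x A.+ y) B.≈ h x B.+ h y) →
             ∀ {n} (f : Fin n → A.Carrier) → h (SemiringSum.sum A f) B.≈ SemiringSum.sum B (h ∘ f)
  sum-homo h h0 h+ {zero}  f = h0
  sum-homo h h0 h+ {suc n} f = B.trans (h+ _ _) (B.+-congˡ (sum-homo h h0 h+ (f ∘ suc)))

toℚᵘ-fromℕ : ∀ n → ℚ.toℚᵘ (fromℕ n) ≃ᵘ mkℚᵘ (+ n) 0
toℚᵘ-fromℕ n = ℚ.toℚᵘ-fromℚᵘ (mkℚᵘ (+ n) 0)

fromℕ-homo-+ : ∀ m n → fromℕ (m ℕ.+ n) ≡ fromℕ m ℚ.+ fromℕ n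
fromℕ-homo-+ m n = ℚ.toℚᵘ-injective (ℚᵘ.≃-trans (toℚᵘ-fromℕ (m ℕ.+ n)) (ℚᵘ.≃-trans
  (*≡* (solve 2 (λ m n → (m :+ n) :* con (+ 1) := (m :* con (+ 1) :+ n :* con (+ 1)) :* con (+ 1)) ≡.refl (+ m) (+ n)))
  (ℚᵘ.≃-sym (ℚᵘ.≃-trans (ℚ.toℚᵘ-homo-+ (fromℕ m) (fromℕ n)) (ℚᵘ.+-cong (toℚᵘ-fromℕ m) (toℚᵘ-fromℕ n))))))
  where open ℤ.+-*-Solver

fromℕ-homo-* : ∀ m n → fromℕ (m ℕ.* n) ≡ fromℕ m ℚ.* fromℕ n
fromℕ-homo-* m n = ℚ.toℚᵘ-injective (ℚᵘ.≃-trans (toℚᵘ-fromℕ (m ℕ.* n)) (ℚᵘ.≃-trans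
  (*≡* (≡.cong (ℤ._* + 1) (ℤ.pos-* m n)))
  (ℚᵘ.≃-sym (ℚᵘ.≃-trans (ℚ.toℚᵘ-homo-* (fromℕ m) (fromℕ n)) (ℚᵘ.*-cong (toℚᵘ-fromℕ m) (toℚᵘ-fromℕ n))))))

fromℕ-^2 : ∀ n → fromℕ n ℚ.* fromℕ n ≡ fromℕ (n ℕ.^ 2)
fromℕ-^2 n = ≡.trans (≡.sym (fromℕ-homo-* n n)) (≡.cong (λ m → fromℕ (n ℕ.* m)) (≡.sym (ℕ.*-identityʳ n)))

fromℕ-positive : ∀ {n} → 0 ℕ.< n → ℚ.Positive (fromℕ n)
fromℕ-positive {n} 0<n = ℚ.normalize-pos n 1 {{_}} {{ℕ.>-nonZero 0<n}}

fromℕ≢0 : ∀ {n} → 0 ℕ.< n → fromℕ n ≢ 0ℚ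
fromℕ≢0 0<n n≡0 = ℚ.<-irrefl (≡.sym n≡0) (ℚ.positive⁻¹ _ {{fromℕ-positive 0<n}})

*-cancelˡ : ∀ {x y z} → x ≢ 0ℚ → x ℚ.* y ≡ x ℚ.* z → y ≡ z
*-cancelˡ {x} {y} {z} x≢0 xy≡xz = ≡.trans (expand y) (≡.trans (≡.cong (ℚ.1/ x ℚ.*_) xy≡xz) (≡.sym (expand z)))
  where
  instance x-nonZero = ℚ.≢-nonZero x≢0
  expand : ∀ y → y ≡ ℚ.1/ x ℚ.* (x ℚ.* y)
  expand y = ≡.trans (≡.sym (ℚ.*-identityˡ y))
    (≡.trans (≡.cong (ℚ._* y) (≡.sym (ℚ.*-inverseˡ x))) (ℚ.*-assoc (ℚ.1/ x) x y))

x*x≡0⇒x≡0 : ∀ x → x ℚ.* x ≡ 0ℚ → x ≡ 0ℚ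
x*x≡0⇒x≡0 x xx≡0 with x ℚ.≟ 0ℚ
... | yes x≡0 = x≡0
... | no  x≢0 = *-cancelˡ x≢0 (≡.trans xx≡0 (≡.sym (ℚ.*-zeroʳ x)))

0≤x*x : ∀ x → 0ℚ ℚ.≤ x ℚ.* x
0≤x*x x with ℚ.≤-total 0ℚ x
... | inj₁ 0≤x = ℚ.nonNegative⁻¹ _ {{ℚ.nonNeg*nonNeg⇒nonNeg x {{ℚ.nonNegative 0≤x}} x {{ℚ.nonNegative 0≤x}}}}
... | inj₂ x≤0 = ℚ.nonNegative⁻¹ _ {{ℚ.nonPos*nonPos⇒nonPos x {{ℚ.nonPositive x≤0}} x {{ℚ.nonPositive x≤0}}}}

module _ where
  open Sums ℚ-ring using (sum)

  sum-nonNegative : ∀ {n} (f : Fin n → ℚ) → (∀ i → 0ℚ ℚ.≤ f i) → 0ℚ ℚ.≤ sum f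
  sum-nonNegative {zero}  f 0≤f = ℚ.≤-refl
  sum-nonNegative {suc n} f 0≤f = ℚ.+-mono-≤ (0≤f zero) (sum-nonNegative (f ∘ suc) (0≤f ∘ suc))

  sum≡0⇒≡0 : ∀ {n} (f : Fin n → ℚ) → (∀ i → 0ℚ ℚ.≤ f i) → sum f ≡ 0ℚ → ∀ i → f i ≡ 0ℚ
  sum≡0⇒≡0 {suc n} f 0≤f Σf≡0 = λ { zero → head≡0 ; (suc i) → sum≡0⇒≡0 (f ∘ suc) (0≤f ∘ suc) tail≡0 i }
    where
    t = sum (f ∘ suc)
    0≤t : 0ℚ ℚ.≤ t
    0≤t = sum-nonNegative (f ∘ suc) (0≤f ∘ suc)
    head≡0 : f zero ≡ 0ℚ
    head≡0 = ℚ.≤-antisym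
      (ℚ.≤-trans (ℚ.≤-reflexive (≡.sym (ℚ.+-identityʳ _))) (ℚ.≤-trans (ℚ.+-monoʳ-≤ (f zero) 0≤t) (ℚ.≤-reflexive Σf≡0)))
      (0≤f zero)
    tail≡0 : t ≡ 0ℚ
    tail≡0 = ≡.trans (≡.sym (ℚ.+-identityˡ t)) (≡.trans (≡.cong (ℚ._+ t) (≡.sym head≡0)) Σf≡0)

module _ where
  open MatrixAlgebra ℚ-ring
  open Sums ℚ-ring
  open Powers ℚ-ring using ([a-b]+b≈a; a-b≈0⇒a≈b)
  open ≡.≡-Reasoning

  -- With B = AᵀA, the entries of B - x𝕀 have sum of squares tr(B²) - 2x tr B + n x² = 0,
  -- as B² = xB and tr B = tr AAᵀ = n x.
  gram-transpose : ∀ {n x} (A : Matrix n n) → A ⊗ A ᵀ ≋ x • 𝕀 → A ᵀ ⊗ A ≋ x • 𝕀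
  gram-transpose {n} {x} A AAᵀ i j =
    a-b≈0⇒a≈b (x*x≡0⇒x≡0 _ (sum≡0⇒≡0 _ (λ j → 0≤x*x (E i j))
      (sum≡0⇒≡0 S (λ i → sum-nonNegative _ (λ j → 0≤x*x (E i j))) total i) j))
    where
    B E : Matrix n n
    B = A ᵀ ⊗ A
    E i j = B i j ℚ.- x ℚ.* 𝕀 i j
    S : Fin n → ℚ
    S i = sum λ j → E i j ℚ.* E i j
    diagonal : ∀ i → 𝕀 i i ≡ 1ℚ
    diagonal i = δ-≡ {i = i} ≡.refl
    select : ∀ i (f : Fin n → ℚ) → sum (λ j → (x ℚ.* 𝕀 i j) ℚ.* f j) ≡ x ℚ.* f i
    select i f = begin
      sum (λ j → (x ℚ.* 𝕀 i j) ℚ.* f j)   ≡⟨ sum-cong-≋ (λ j → ℚ.*-assoc x (𝕀 i j) (f j)) ⟩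
      sum (λ j → x ℚ.* (𝕀 i j ℚ.* f j))   ≡⟨ *-distribˡ-sum x (λ j → 𝕀 i j ℚ.* f j) ⟨
      x ℚ.* sum (λ j → 𝕀 i j ℚ.* f j)     ≡⟨ ≡.cong (x ℚ.*_) (sum-δ i f) ⟩
      x ℚ.* f i                           ∎
    -- The cross terms of the squares are added on the left instead of subtracted on the right;
    -- `select` sums each copy to x B i i. The squares of row i of B sum to x B i i because `gram-⊗`
    -- gives B Bᵀ = xB.
    row : ∀ i → S i ℚ.+ x ℚ.* B i i ≡ x ℚ.* x
    row i = ℚ+-cancelʳ (x ℚ.* B i i) (begin
      (S i ℚ.+ x ℚ.* B i i) ℚ.+ x ℚ.* B i i
        ≡⟨ ≡.cong (λ y → (S i ℚ.+ y) ℚ.+ y) (select i (B i)) ⟨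
      (S i ℚ.+ sum (λ j → xδ j ℚ.* B i j)) ℚ.+ sum (λ j → xδ j ℚ.* B i j)
        ≡⟨ ≡.cong (ℚ._+ sum (λ j → xδ j ℚ.* B i j)) (∑-distrib-+ (λ j → E i j ℚ.* E i j) (λ j → xδ j ℚ.* B i j)) ⟨
      sum (λ j → E i j ℚ.* E i j ℚ.+ xδ j ℚ.* B i j) ℚ.+ sum (λ j → xδ j ℚ.* B i j)
        ≡⟨ ∑-distrib-+ (λ j → E i j ℚ.* E i j ℚ.+ xδ j ℚ.* B i j) (λ j → xδ j ℚ.* B i j) ⟨
      sum (λ j → (E i j ℚ.* E i j ℚ.+ xδ j ℚ.* B i j) ℚ.+ xδ j ℚ.* B i j)
        ≡⟨ sum-cong-≋ (λ j → square (B i j) (xδ j)) ⟩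
      sum (λ j → B i j ℚ.* B i j ℚ.+ xδ j ℚ.* xδ j)
        ≡⟨ ∑-distrib-+ (λ j → B i j ℚ.* B i j) (λ j → xδ j ℚ.* xδ j) ⟩
      sum (λ j → B i j ℚ.* B i j) ℚ.+ sum (λ j → xδ j ℚ.* xδ j)
        ≡⟨ ≡.cong₂ ℚ._+_ (gram-⊗ {x = x} (A ᵀ) (A ᵀ) {A} AAᵀ i i) (select i xδ) ⟩
      x ℚ.* B i i ℚ.+ x ℚ.* (x ℚ.* 𝕀 i i)
        ≡⟨ ≡.cong (λ y → x ℚ.* B i i ℚ.+ x ℚ.* (x ℚ.* y)) (diagonal i) ⟩
      x ℚ.* B i i ℚ.+ x ℚ.* (x ℚ.* 1ℚ)
        ≡⟨ ≡.cong (λ y → x ℚ.* B i i ℚ.+ x ℚ.* y) (ℚ.*-identityʳ x) ⟩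
      x ℚ.* B i i ℚ.+ x ℚ.* x
        ≡⟨ ℚ.+-comm (x ℚ.* B i i) (x ℚ.* x) ⟩
      x ℚ.* x ℚ.+ x ℚ.* B i i ∎)
      where
      xδ : Fin n → ℚ
      xδ j = x ℚ.* 𝕀 i j
      square : ∀ b d → ((b ℚ.- d) ℚ.* (b ℚ.- d) ℚ.+ d ℚ.* b) ℚ.+ d ℚ.* b ≡ b ℚ.* b ℚ.+ d ℚ.* d
      square = solve 2 (λ b d → ((b :- d) :* (b :- d) :+ d :* b) :+ d :* b := b :* b :+ d :* d) ≡.refl
        where open +-*-Solver
      ℚ+-cancelʳ : ∀ y {v w} → v ℚ.+ y ≡ w ℚ.+ y → v ≡ w
      ℚ+-cancelʳ y = Powers.+-cancelʳ ℚ-ring y _ _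
    trace : sum (λ i → B i i) ≡ sum {n} (λ _ → x)
    trace = begin
      sum (λ i → sum λ k → A k i ℚ.* A k i)   ≡⟨ ∑-comm (λ i k → A k i ℚ.* A k i) ⟩
      sum (λ k → sum λ i → A k i ℚ.* A k i)   ≡⟨ sum-cong-≋ (λ k → ≡.trans (AAᵀ k k) (≡.trans (≡.cong (x ℚ.*_) (diagonal k)) (ℚ.*-identityʳ x))) ⟩
      sum {n} (λ _ → x)                       ∎
    total : sum S ≡ 0ℚ
    total = Powers.+-identityˡ-unique ℚ-ring (sum S) (sum {n} (λ _ → x ℚ.* x)) (begin
      sum S ℚ.+ sum {n} (λ _ → x ℚ.* x)             ≡⟨ ≡.cong (sum S ℚ.+_) (*-distribˡ-sum {n} x (λ _ → x)) ⟨
      sum S ℚ.+ x ℚ.* sum {n} (λ _ → x)             ≡⟨ ≡.cong (λ y → sum S ℚ.+ x ℚ.* y) trace ⟨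
      sum S ℚ.+ x ℚ.* sum (λ i → B i i)             ≡⟨ ≡.cong (sum S ℚ.+_) (*-distribˡ-sum x (λ i → B i i)) ⟩
      sum S ℚ.+ sum (λ i → x ℚ.* B i i)             ≡⟨ ∑-distrib-+ S (λ i → x ℚ.* B i i) ⟨
      sum (λ i → S i ℚ.+ x ℚ.* B i i)               ≡⟨ sum-cong-≋ row ⟩
      sum {n} (λ _ → x ℚ.* x)                       ∎)

-- Entries of designs and their specialisation

Ternary : ℚ → Set
Ternary x = x ≡ 0ℚ ⊎ x ≡ 1ℚ ⊎ x ≡ ℚ.- 1ℚ

ternary-* : ∀ {x y} → Ternary x → Ternary y → Ternary (x ℚ.* y)
ternary-* {y = y} (inj₁ ≡.refl) _ = inj₁ (ℚ.*-zeroˡ y)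
ternary-* {y = y} (inj₂ (inj₁ ≡.refl)) t = ≡.subst Ternary (≡.sym (ℚ.*-identityˡ y)) t
ternary-* (inj₂ (inj₂ ≡.refl)) (inj₁ ≡.refl) = inj₁ ≡.refl
ternary-* (inj₂ (inj₂ ≡.refl)) (inj₂ (inj₁ ≡.refl)) = inj₂ (inj₂ ≡.refl)
ternary-* (inj₂ (inj₂ ≡.refl)) (inj₂ (inj₂ ≡.refl)) = inj₂ (inj₁ ≡.refl)

module PolynomialLemmas {u : ℕ} where
  open OrthogonalDesigns {u} using (Poly; con; var; quadraticForm; commutativeRing)
  open CommutativeRing commutativeRing hiding (zero)
  open Powers commutativeRing
  open Sums commutativeRing using (sum; sum-cong-≋; *-distribʳ-sum)
  open SetoidReasoning setoid

  con-* : ∀ x y → con (x ℚ.* y) ≈ con x * con y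
  con-* = Polynomials.con-*

  -- `con` respects sums, so `con (- 1)` is the additive inverse of 1.
  con--1 : ∀ f → con (ℚ.- 1ℚ) * f ≈ - f
  con--1 f = trans (*-congʳ (+-inverseʳ-unique 1# (con (ℚ.- 1ℚ)) (sym (Polynomials.con-+ 1ℚ (ℚ.- 1ℚ))))) (-1*x≈-x f)

  con-sum : ∀ {n} (f : Fin n → ℚ) → con (Sums.sum ℚ-ring f) ≈ sum (con ∘ f)
  con-sum = sum-homo (CommutativeRing.semiring ℚ-ring) semiring con refl Polynomials.con-+

  Entry : Poly → Set
  Entry f = f ≈ con 0ℚ ⊎ (∃[ l ] (f ≈ var l ⊎ f ≈ - var l))

  entry-cong : ∀ {f g} → f ≈ g → Entry g → Entry f
  entry-cong f≈g (inj₁ g≈0)               = inj₁ (trans f≈g g≈0)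
  entry-cong f≈g (inj₂ (l , inj₁ g≈var))  = inj₂ (l , inj₁ (trans f≈g g≈var))
  entry-cong f≈g (inj₂ (l , inj₂ g≈-var)) = inj₂ (l , inj₂ (trans f≈g g≈-var))

  entry-neg : ∀ {f} → Entry f → Entry (- f)
  entry-neg (inj₁ f≈0)               = inj₁ (trans (-‿cong f≈0) -0#≈0#)
  entry-neg (inj₂ (l , inj₁ f≈var))  = inj₂ (l , inj₂ (-‿cong f≈var))
  entry-neg (inj₂ (l , inj₂ f≈-var)) = inj₂ (l , inj₁ (trans (-‿cong f≈-var) (-‿involutive (var l))))

  ternary-entry : ∀ {x f} → Ternary x → Entry f → Entry (con x * f)
  ternary-entry {f = f} (inj₁ ≡.refl)        _     = inj₁ (zeroˡ f)
  ternary-entry {f = f} (inj₂ (inj₁ ≡.refl)) entry = entry-cong (*-identityˡ f) entry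
  ternary-entry {f = f} (inj₂ (inj₂ ≡.refl)) entry = entry-cong (con--1 f) (entry-neg entry)

  quadraticForm-scale : ∀ k s → quadraticForm (λ i → k ℕ.* s i) ≈ quadraticForm s * con (fromℕ k)
  quadraticForm-scale k s = begin
    sum (λ i → con (fromℕ (k ℕ.* s i)) * x² i)            ≈⟨ sum-cong-≋ scale ⟩
    sum (λ i → con (fromℕ (s i)) * x² i * con (fromℕ k))  ≈⟨ *-distribʳ-sum (con (fromℕ k)) (λ i → con (fromℕ (s i)) * x² i) ⟨
    quadraticForm s * con (fromℕ k)                       ∎
    where
    x² : Fin u → Poly
    x² i = var i * var i
    scale : ∀ i → con (fromℕ (k ℕ.* s i)) * x² i ≈ con (fromℕ (s i)) * x² i * con (fromℕ k)
    scale i = begin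
      con (fromℕ (k ℕ.* s i)) * x² i              ≡⟨ ≡.cong (λ a → con a * x² i) (≡.trans (fromℕ-homo-* k (s i)) (ℚ.*-comm (fromℕ k) (fromℕ (s i)))) ⟩
      con (fromℕ (s i) ℚ.* fromℕ k) * x² i        ≈⟨ *-congʳ (con-* (fromℕ (s i)) (fromℕ k)) ⟩
      con (fromℕ (s i)) * con (fromℕ k) * x² i    ≈⟨ *-assoc _ _ _ ⟩
      con (fromℕ (s i)) * (con (fromℕ k) * x² i)  ≈⟨ *-congˡ (*-comm _ _) ⟩
      con (fromℕ (s i)) * (x² i * con (fromℕ k))  ≈⟨ *-assoc _ _ _ ⟨
      con (fromℕ (s i)) * x² i * con (fromℕ k)    ∎

module Evaluation {u : ℕ} (v : Fin u → ℚ) where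
  open Polynomials u

  evaluate : Poly → ℚ
  evaluate (con a) = a
  evaluate (var i) = v i
  evaluate (f + g) = evaluate f ℚ.+ evaluate g
  evaluate (f * g) = evaluate f ℚ.* evaluate g
  evaluate (- f)   = ℚ.- evaluate f

  -- Evaluation is well defined on the polynomial ring, since each generator of the congruence
  -- becomes a law of ℚ.
  evaluate-cong : ∀ {f g} → f ≈ g → evaluate f ≡ evaluate g
  evaluate-cong refl              = ≡.refl
  evaluate-cong (sym f≈g)         = ≡.sym (evaluate-cong f≈g)
  evaluate-cong (trans f≈g g≈h)   = ≡.trans (evaluate-cong f≈g) (evaluate-cong g≈h)
  evaluate-cong (+-cong f≈ g≈)    = ≡.cong₂ ℚ._+_ (evaluate-cong f≈) (evaluate-cong g≈)
  evaluate-cong (*-cong f≈ g≈)    = ≡.cong₂ ℚ._*_ (evaluate-cong f≈) (evaluate-cong g≈)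
  evaluate-cong (neg-cong f≈)     = ≡.cong ℚ.-_ (evaluate-cong f≈)
  evaluate-cong (+-assoc f g h)   = ℚ.+-assoc (evaluate f) (evaluate g) (evaluate h)
  evaluate-cong (+-comm f g)      = ℚ.+-comm (evaluate f) (evaluate g)
  evaluate-cong (+-identityʳ f)   = ℚ.+-identityʳ (evaluate f)
  evaluate-cong (+-inverseʳ f)    = ℚ.+-inverseʳ (evaluate f)
  evaluate-cong (*-assoc f g h)   = ℚ.*-assoc (evaluate f) (evaluate g) (evaluate h)
  evaluate-cong (*-comm f g)      = ℚ.*-comm (evaluate f) (evaluate g)
  evaluate-cong (*-identityʳ f)   = ℚ.*-identityʳ (evaluate f)
  evaluate-cong (*-distribˡ f g h) = ℚ.*-distribˡ-+ (evaluate f) (evaluate g) (evaluate h)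
  evaluate-cong (con-+ a b)       = ≡.refl
  evaluate-cong (con-* a b)       = ≡.refl

  evaluate-sum : ∀ {n} (f : Fin n → Poly) → evaluate (Sums.sum commutativeRing f) ≡ Sums.sum ℚ-ring (evaluate ∘ f)
  evaluate-sum = sum-homo (CommutativeRing.semiring commutativeRing) (CommutativeRing.semiring ℚ-ring)
    evaluate ≡.refl (λ _ _ → ≡.refl)

  evaluate-entry : (∀ i → Ternary (v i)) → ∀ {f} → PolynomialLemmas.Entry f → Ternary (evaluate f)
  evaluate-entry ternary (inj₁ f≈0)               = inj₁ (evaluate-cong f≈0)
  evaluate-entry ternary (inj₂ (l , inj₁ f≈var))  = ≡.subst Ternary (≡.sym (evaluate-cong f≈var)) (ternary l)
  evaluate-entry ternary (inj₂ (l , inj₂ f≈-var)) = ≡.subst Ternary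
    (≡.sym (≡.trans (evaluate-cong f≈-var) (≡.trans (≡.cong ℚ.-_ (≡.sym (ℚ.*-identityˡ (v l)))) (ℚ.neg-distribˡ-* 1ℚ (v l)))))
    (ternary-* (inj₂ (inj₂ ≡.refl)) (ternary l))

module Indicator {u} (S : Subset u) where
  indicator : Fin u → ℚ
  indicator i = if does (i ∈? S) then 1ℚ else 0ℚ

  open Evaluation indicator public

  indicator-ternary : ∀ i → Ternary (indicator i)
  indicator-ternary i with does (i ∈? S)
  ... | true  = inj₂ (inj₁ ≡.refl)
  ... | false = inj₁ ≡.refl

  -- The indicator takes the values 0 and 1, so squaring does not change it and exactly the terms
  -- over `S` survive.
  evaluate-quadraticForm : ∀ s → evaluate (OrthogonalDesigns.quadraticForm s) ≡ fromℕ (sumOver S s)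
  evaluate-quadraticForm s = ≡.trans
    (evaluate-sum (λ i → con (fromℕ (s i)) * (var i * var i)))
    (≡.trans (Sums.sum-cong-≋ ℚ-ring term)
      (≡.sym (sum-homo ℕ.+-*-semiring (CommutativeRing.semiring ℚ-ring) fromℕ ≡.refl fromℕ-homo-+
        (λ i → if does (i ∈? S) then s i else 0))))
    where
    open Polynomials u
    term : ∀ i → fromℕ (s i) ℚ.* (indicator i ℚ.* indicator i) ≡ fromℕ (if does (i ∈? S) then s i else 0)
    term i with does (i ∈? S)
    ... | true  = ℚ.*-identityʳ (fromℕ (s i))
    ... | false = ℚ.*-zeroʳ (fromℕ (s i))

  sumOver-positive : ∀ {s} → (∀ i → 0 ℕ.< s i) → Nonempty S → 0 ℕ.< sumOver S s
  sumOver-positive {s} 0<s (i , i∈S) = ℕ.<-≤-trans (0<s i)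
    (ℕ.≤-trans (ℕ.≤-reflexive (≡.sym (≡.cong (λ b → if b then s i else 0) (dec-true (i ∈? S) i∈S))))
               (term≤sum (λ i → if does (i ∈? S) then s i else 0) i))
    where
    term≤sum : ∀ {n} (f : Fin n → ℕ) i → f i ℕ.≤ SemiringSum.sum ℕ.+-*-semiring f
    term≤sum f zero    = ℕ.m≤m+n (f zero) _
    term≤sum f (suc i) = ℕ.≤-trans (term≤sum (f ∘ suc) i) (ℕ.m≤n+m _ (f zero))

-- The orthogonal designs

module Construction
  {m q} (net : Net m q) k (W : ℚ-Mat.Matrix m m) (W-weighing : IsWeighingMatrix m k W)
  {u} (s : Fin u → ℕ) (D₀ : OrthogonalDesigns.Matrix m m) (D₀-design : OrthogonalDesigns.IsOrthogonalDesign {u} m s D₀)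
  where
  open Net net
  open OrthogonalDesigns {u} using (Poly; con; var; quadraticForm; commutativeRing; IsOrthogonalDesign)
  open PolynomialLemmas {u}
  private
    n = m ℕ.* q
    module ℚM = MatrixAlgebra ℚ-ring
    module PM = MatrixAlgebra commutativeRing
    module P = CommutativeRing commutativeRing
    σ = quadraticForm s

  quot : Fin n → Fin m
  quot = quotient {m} q

  rem : Fin n → Fin q
  rem = remainder {m} q

  -- Row `combine a y` is row `a` of `W`, spread over the points of line `y` of class `suc t`.
  L : Fin m → ℚM.Matrix n n
  L t r x = ℚM.inflate q W r (π (suc t) ⟨$⟩ʳ x)

  -- Here the points index the rows: column `combine b y` is column `b` of `D₀`, spread over line
  -- `y` of class 0.
  M : PM.Matrix n n
  M x r = PM.inflate q D₀ (π zero ⟨$⟩ʳ x) r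

  D : Fin m → PM.Matrix n n
  D t = (λ r x → con (L t r x)) PM.⊗ M

  -- For distinct indices this is the (0,1,-1)-matrix that unbiasedness asks for; for equal ones it
  -- is k𝕀.
  G : Fin m → Fin m → ℚM.Matrix n n
  G t t′ = L t ℚM.⊗ L t′ ℚM.ᵀ

  L-gram : ∀ t → G t t ℚM.≋ fromℕ k ℚM.• ℚM.𝕀
  L-gram t = ℚM.permute-columns-gram {x = fromℕ k} (ℚM.inflate q W) (π (suc t)) (ℚM.inflate-gram q {fromℕ k} {W} (proj₂ W-weighing))

  M-gram : M PM.⊗ M PM.ᵀ PM.≋ σ PM.• PM.𝕀
  M-gram = PM.permute-rows-gram (PM.inflate q D₀) (π zero) (PM.inflate-gram q {A = D₀} (proj₂ D₀-design))

  D-gram : ∀ t t′ → D t PM.⊗ D t′ PM.ᵀ PM.≋ σ PM.• (λ i j → con (G t t′ i j))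
  D-gram t t′ i j = P.trans (PM.gram-⊗ {x = σ} (λ r x → con (L t r x)) (λ r x → con (L t′ r x)) {M} M-gram i j)
    (P.*-congˡ {σ} (P.sym (P.trans (con-sum (λ x → L t i x ℚ.* L t′ j x))
      (Sums.sum-cong-≋ commutativeRing λ x → con-* (L t i x) (L t′ j x)))))

  𝕀-ternary : ∀ {n} (i j : Fin n) → Ternary (ℚM.𝕀 i j)
  𝕀-ternary i j with does (i Fin.≟ j)
  ... | true  = inj₂ (inj₁ ≡.refl)
  ... | false = inj₁ ≡.refl

  L-ternary : ∀ t r x → Ternary (L t r x)
  L-ternary t r x = ternary-* (proj₁ W-weighing (quot r) (quot (π (suc t) ⟨$⟩ʳ x))) (𝕀-ternary (rem r) (line (suc t) x))

  L-support : ∀ t r x → rem r ≢ line (suc t) x → L t r x ≡ 0ℚ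
  L-support t r x r≢x = ≡.trans (≡.cong (W _ _ ℚ.*_) (Sums.δ-≢ ℚ-ring r≢x)) (ℚ.*-zeroʳ (W _ _))

  M-entry : ∀ x r → Entry (M x r)
  M-entry x r with does (line zero x Fin.≟ rem r)
  ... | true  = entry-cong (P.*-identityʳ _) (proj₁ D₀-design _ _)
  ... | false = inj₁ (P.zeroʳ (D₀ (quot (π zero ⟨$⟩ʳ x)) (quot r)))

  M-support : ∀ x r → line zero x ≢ rem r → M x r P.≈ P.0#
  M-support x r x≢r = P.trans (P.*-congˡ {D₀ (quot (π zero ⟨$⟩ʳ x)) (quot r)} (Sums.δ-≢ commutativeRing x≢r)) (P.zeroʳ _)

  D-entry : ∀ t i j → Entry (D t i j)
  D-entry t i j with PM.sum-at-most-one (λ x → con (L t i x) P.* M x j)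
    {λ x → rem i ≡ line (suc t) x × line zero x ≡ rem j}
    (λ x → (rem i Fin.≟ line (suc t) x) ×-dec (line zero x Fin.≟ rem j))
    (λ (ix , xj) (iy , yj) → meet-once {suc t} {zero} (λ ()) (≡.trans (≡.sym ix) iy) (≡.trans xj (≡.sym yj)))
    off-support
    where
    off-support : ∀ x → ¬ (rem i ≡ line (suc t) x × line zero x ≡ rem j) → con (L t i x) P.* M x j P.≈ P.0#
    off-support x ¬both = case rem i Fin.≟ line (suc t) x of λ where
      (yes ix) → P.trans (P.*-congˡ {con (L t i x)} (M-support x j λ xj → ¬both (ix , xj))) (P.zeroʳ (con (L t i x)))
      (no ¬ix) → P.trans (P.*-congʳ {M x j} (P.reflexive (≡.cong con (L-support t i x ¬ix)))) (P.zeroˡ (M x j))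
  ... | inj₁ D≈0         = inj₁ D≈0
  ... | inj₂ (x , _ , D≈) = entry-cong D≈ (ternary-entry (L-ternary t i x) (M-entry x j))

  module _ {t t′ : Fin m} (t≢t′ : t ≢ t′) (i j : Fin n) where

    OnBoth : Fin n → Set
    OnBoth x = rem i ≡ line (suc t) x × rem j ≡ line (suc t′) x

    onBoth-unique : ∀ {x y} → OnBoth x → OnBoth y → x ≡ y
    onBoth-unique (ix , jx) (iy , jy) =
      meet-once (t≢t′ ∘ Fin.suc-injective) (≡.trans (≡.sym ix) iy) (≡.trans (≡.sym jx) jy)

    G-term : ∀ x → ¬ OnBoth x → L t i x ℚ.* L t′ j x ≡ 0ℚ
    G-term x ¬both = case rem i Fin.≟ line (suc t) x of λ where
      (yes ix) → ≡.trans (≡.cong (L t i x ℚ.*_) (L-support t′ j x λ jx → ¬both (ix , jx))) (ℚ.*-zeroʳ (L t i x))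
      (no ¬ix) → ≡.trans (≡.cong (ℚ._* L t′ j x) (L-support t i x ¬ix)) (ℚ.*-zeroˡ (L t′ j x))

    G-value : G t t′ i j ≡ 0ℚ ⊎ (∃[ x ] OnBoth x × G t t′ i j ≡ L t i x ℚ.* L t′ j x)
    G-value = ℚM.sum-at-most-one (λ x → L t i x ℚ.* L t′ j x) {OnBoth}
      (λ x → (rem i Fin.≟ line (suc t) x) ×-dec (rem j Fin.≟ line (suc t′) x)) onBoth-unique G-term

    G-at : ∀ {x} → OnBoth x → G t t′ i j ≡ L t i x ℚ.* L t′ j x
    G-at {x} both = Sums.sum-single ℚ-ring (λ x → L t i x ℚ.* L t′ j x) x
      λ y y≢x → G-term y λ both′ → y≢x (onBoth-unique both′ both)

    G-ternary : Ternary (G t t′ i j)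
    G-ternary with G-value
    ... | inj₁ G≡0         = inj₁ G≡0
    ... | inj₂ (x , _ , G≡) = ≡.subst Ternary (≡.sym G≡) (ternary-* (L-ternary t i x) (L-ternary t′ j x))

  -- G Gᵀ regroups as L_t (L_t′ᵀ L_t′) L_tᵀ; `gram-transpose` makes the middle factor k𝕀, and the
  -- outer product gives the second factor `k`.
  G-weighing : ∀ {t t′} → t ≢ t′ → IsWeighingMatrix n (k ℕ.^ 2) (G t t′)
  G-weighing {t} {t′} t≢t′ = G-ternary t≢t′ , λ i j → begin
    (G t t′ ℚM.⊗ G t t′ ℚM.ᵀ) i j
      ≡⟨ ℚM.gram-⊗ {x = fromℕ k} (L t) (L t) {L t′ ℚM.ᵀ} (gram-transpose {x = fromℕ k} (L t′) (L-gram t′)) i j ⟩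
    fromℕ k ℚ.* G t t i j
      ≡⟨ ≡.cong (fromℕ k ℚ.*_) (L-gram t i j) ⟩
    fromℕ k ℚ.* (fromℕ k ℚ.* ℚM.𝕀 i j)
      ≡⟨ ℚ.*-assoc (fromℕ k) (fromℕ k) (ℚM.𝕀 i j) ⟨
    fromℕ k ℚ.* fromℕ k ℚ.* ℚM.𝕀 i j
      ≡⟨ ≡.cong (ℚ._* ℚM.𝕀 i j) (fromℕ-^2 k) ⟩
    fromℕ (k ℕ.^ 2) ℚ.* ℚM.𝕀 i j ∎
    where open ≡.≡-Reasoning

  module _ (0<k : 0 ℕ.< k) {t t′ : Fin m} (t≢t′ : t ≢ t′) (G≋k𝕀 : G t t′ ℚM.≋ fromℕ k ℚM.• ℚM.𝕀) where

    -- The first step towards refuting that `G t t′` is k𝕀, which would follow if the designs, or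
    -- the weighing matrices, of `t` and `t′` coincided.
    G-diagonal≢0 : ∀ r → G t t′ r r ≢ 0ℚ
    G-diagonal≢0 r G≡0 = fromℕ≢0 0<k (begin
      fromℕ k                    ≡⟨ ℚ.*-identityʳ (fromℕ k) ⟨
      fromℕ k ℚ.* 1ℚ             ≡⟨ ≡.cong (fromℕ k ℚ.*_) (Sums.δ-≡ ℚ-ring {i = r} ≡.refl) ⟨
      fromℕ k ℚ.* ℚM.𝕀 r r       ≡⟨ G≋k𝕀 r r ⟨
      G t t′ r r                 ≡⟨ G≡0 ⟩
      0ℚ                         ∎)
      where open ≡.≡-Reasoning

    -- A nonzero diagonal entry is a product at the single common point of two lines, so neither
    -- factor vanishes.
    meeting-point : ∀ r → ∃[ x ] OnBoth t≢t′ r r x × L t r x ≢ 0ℚ × L t′ r x ≢ 0ℚ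
    meeting-point r with G-value t≢t′ r r
    ... | inj₁ G≡0 = ⊥-elim (G-diagonal≢0 r G≡0)
    ... | inj₂ (x , both , G≡) = x , both , L≢0 , L′≢0
      where
      LL′≢0 : L t r x ℚ.* L t′ r x ≢ 0ℚ
      LL′≢0 LL′≡0 = G-diagonal≢0 r (≡.trans G≡ LL′≡0)
      L≢0 : L t r x ≢ 0ℚ
      L≢0 L≡0 = LL′≢0 (≡.trans (≡.cong (ℚ._* L t′ r x) L≡0) (ℚ.*-zeroˡ (L t′ r x)))
      L′≢0 : L t′ r x ≢ 0ℚ
      L′≢0 L′≡0 = LL′≢0 (≡.trans (≡.cong (L t r x ℚ.*_) L′≡0) (ℚ.*-zeroʳ (L t r x)))

    -- Rows (t , y) and (t′ , y) of L t and L t′ are nonzero at the single point where the two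
    -- lines named y meet, so G t t′ has a nonzero off-diagonal entry.
    G-not-scalar : Fin q → ⊥
    G-not-scalar y with meeting-point (combine t y) | meeting-point (combine t′ y)
    ... | x , (rx , rx′) , L≢0 , _ | z , (rz , rz′) , _ , L′≢0 = L′z≢0 (*-cancelˡ L≢0 (begin
      L t r x ℚ.* L t′ r′ x    ≡⟨ G-at t≢t′ r r′ both ⟨
      G t t′ r r′              ≡⟨ G≋k𝕀 r r′ ⟩
      fromℕ k ℚ.* ℚM.𝕀 r r′    ≡⟨ ≡.cong (fromℕ k ℚ.*_) (Sums.δ-≢ ℚ-ring r≢r′) ⟩
      fromℕ k ℚ.* 0ℚ           ≡⟨ ℚ.*-zeroʳ (fromℕ k) ⟩
      0ℚ                       ≡⟨ ℚ.*-zeroʳ (L t r x) ⟨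
      L t r x ℚ.* 0ℚ           ∎))
      where
      open ≡.≡-Reasoning
      r r′ : Fin n
      r  = combine t y
      r′ = combine t′ y
      r≢r′ : r ≢ r′
      r≢r′ eq = t≢t′ (Fin.combine-injectiveˡ t y t′ y eq)
      same-line : rem r ≡ rem r′
      same-line = ≡.trans (≡.cong proj₂ (Fin.remQuot-combine t y)) (≡.sym (≡.cong proj₂ (Fin.remQuot-combine t′ y)))
      both : OnBoth t≢t′ r r′ x
      both = rx , ≡.trans (≡.sym same-line) rx′
      -- The points `x` and `z` come from rows `r` and `r′`, but both lie on the two lines named `y`
      -- and therefore agree.
      L′z≢0 : L t′ r′ x ≢ 0ℚ
      L′z≢0 = ≡.subst (λ w → L t′ r′ w ≢ 0ℚ)
        (onBoth-unique t≢t′ r r′ {z} {x} (≡.trans same-line rz , rz′) both) L′≢0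

  con-𝕀 : ∀ (i j : Fin n) → con (ℚM.𝕀 i j) P.≈ PM.𝕀 i j
  con-𝕀 i j with does (i Fin.≟ j)
  ... | true  = P.refl
  ... | false = P.refl

  D-design : ∀ t → IsOrthogonalDesign n (λ i → k ℕ.* s i) (D t)
  D-design t = D-entry t , λ i j → begin
    (D t PM.⊗ D t PM.ᵀ) i j                                     ≈⟨ D-gram t t i j ⟩
    σ P.* con (G t t i j)                                       ≡⟨ ≡.cong (λ a → σ P.* con a) (L-gram t i j) ⟩
    σ P.* con (fromℕ k ℚ.* ℚM.𝕀 i j)                            ≈⟨ P.*-congˡ (con-* (fromℕ k) (ℚM.𝕀 i j)) ⟩
    σ P.* (con (fromℕ k) P.* con (ℚM.𝕀 i j))                    ≈⟨ P.*-assoc σ _ _ ⟨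
    σ P.* con (fromℕ k) P.* con (ℚM.𝕀 i j)                      ≈⟨ P.*-cong (P.sym (quadraticForm-scale k s)) (con-𝕀 i j) ⟩
    quadraticForm (λ i → k ℕ.* s i) P.* PM.𝕀 i j                ∎
    where open SetoidReasoning P.setoid

  D-unbiased : 0 ℕ.< k → ∀ {t t′} → t ≢ t′ →
               OrthogonalDesigns.Unbiased n (λ i → k ℕ.* s i) (fromℕ (k ℕ.^ 2)) (D t) (D t′)
  D-unbiased 0<k {t} {t′} t≢t′ = D-design t , D-design t′ , √α , G t t′ , G-ternary t≢t′ , λ i j → begin
    (D t PM.⊗ D t′ PM.ᵀ) i j                                    ≈⟨ D-gram t t′ i j ⟩
    σ P.* con (G t t′ i j)                                      ≈⟨ P.*-congʳ scale ⟨
    quadraticForm (λ i → k ℕ.* s i) P.* con 1/k P.* con (G t t′ i j) ∎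
    where
    open SetoidReasoning P.setoid
    √α : PositiveSqrt (fromℕ (k ℕ.^ 2))
    √α = record { root = fromℕ k ; root-positive = fromℕ-positive 0<k ; root²≡α = fromℕ-^2 k }
    1/k = PositiveSqrt.inverse √α
    -- The factor `k` in the type (k s_i) cancels against 1/√α = 1/k.
    scale : quadraticForm (λ i → k ℕ.* s i) P.* con 1/k P.≈ σ
    scale = begin
      quadraticForm (λ i → k ℕ.* s i) P.* con 1/k      ≈⟨ P.*-congʳ (quadraticForm-scale k s) ⟩
      σ P.* con (fromℕ k) P.* con 1/k                  ≈⟨ P.*-assoc σ _ _ ⟩
      σ P.* (con (fromℕ k) P.* con 1/k)                ≈⟨ P.*-congˡ (con-* (fromℕ k) 1/k) ⟨
      σ P.* con (fromℕ k ℚ.* 1/k)                      ≡⟨ ≡.cong (λ a → σ P.* con a) (ℚ.*-inverseʳ (fromℕ k) {{ℚ.pos⇒nonZero (fromℕ k) {{fromℕ-positive 0<k}}}}) ⟩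
      σ P.* con 1ℚ                                     ≈⟨ P.*-identityʳ σ ⟩
      σ                                                ∎

  module Specialise (S : Subset u) (S-nonempty : Nonempty S) (0<s : ∀ i → 0 ℕ.< s i) where
    open Indicator S

    σS : ℕ
    σS = sumOver S s

    0<σS : 0 ℕ.< σS
    0<σS = sumOver-positive 0<s S-nonempty

    E : Fin m → ℚM.Matrix n n
    E t i j = evaluate (D t i j)

    E-gram : ∀ t t′ → E t ℚM.⊗ E t′ ℚM.ᵀ ℚM.≋ fromℕ σS ℚM.• G t t′
    E-gram t t′ i j = ≡.trans (≡.sym (evaluate-sum (λ x → D t i x P.* D t′ j x)))
      (≡.trans (evaluate-cong (D-gram t t′ i j)) (≡.cong (ℚ._* G t t′ i j) (evaluate-quadraticForm s)))

    E-weighing : ∀ t → IsWeighingMatrix n (k ℕ.* σS) (E t)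
    E-weighing t = (λ i j → evaluate-entry indicator-ternary (D-entry t i j)) , λ i j → begin
      (E t ℚM.⊗ E t ℚM.ᵀ) i j                      ≡⟨ E-gram t t i j ⟩
      fromℕ σS ℚ.* G t t i j                       ≡⟨ ≡.cong (fromℕ σS ℚ.*_) (L-gram t i j) ⟩
      fromℕ σS ℚ.* (fromℕ k ℚ.* ℚM.𝕀 i j)          ≡⟨ ℚ.*-assoc (fromℕ σS) (fromℕ k) (ℚM.𝕀 i j) ⟨
      fromℕ σS ℚ.* fromℕ k ℚ.* ℚM.𝕀 i j            ≡⟨ ≡.cong (ℚ._* ℚM.𝕀 i j) (≡.trans (ℚ.*-comm (fromℕ σS) (fromℕ k)) (≡.sym (fromℕ-homo-* k σS))) ⟩
      fromℕ (k ℕ.* σS) ℚ.* ℚM.𝕀 i j                ∎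
      where open ≡.≡-Reasoning

    E-quasiUnbiased : ∀ {t t′} → t ≢ t′ →
                      QuasiUnbiased n (k ℕ.* σS) (k ℕ.^ 2) (fromℕ (σS ℕ.^ 2)) (E t) (E t′)
    E-quasiUnbiased {t} {t′} t≢t′ = E-weighing t , E-weighing t′ , √a ,
      (λ i j → ≡.subst Ternary (≡.sym (scaled≡G i j)) (G-ternary t≢t′ i j)) ,
      λ i j → ≡.trans (ℚM.⊗-cong {A′ = G t t′} {B′ = G t t′ ℚM.ᵀ} scaled≡G (λ i j → scaled≡G j i) i j) (proj₂ (G-weighing t≢t′) i j)
      where
      √a : PositiveSqrt (fromℕ (σS ℕ.^ 2))
      √a = record { root = fromℕ σS ; root-positive = fromℕ-positive 0<σS ; root²≡α = fromℕ-^2 σS }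
      1/σ = PositiveSqrt.inverse √a
      scaled≡G : 1/σ ℚM.• (E t ℚM.⊗ E t′ ℚM.ᵀ) ℚM.≋ G t t′
      scaled≡G i j = begin
        1/σ ℚ.* (E t ℚM.⊗ E t′ ℚM.ᵀ) i j      ≡⟨ ≡.cong (1/σ ℚ.*_) (E-gram t t′ i j) ⟩
        1/σ ℚ.* (fromℕ σS ℚ.* G t t′ i j)     ≡⟨ ℚ.*-assoc 1/σ (fromℕ σS) (G t t′ i j) ⟨
        1/σ ℚ.* fromℕ σS ℚ.* G t t′ i j       ≡⟨ ≡.cong (ℚ._* G t t′ i j) (ℚ.*-inverseˡ (fromℕ σS) {{ℚ.pos⇒nonZero (fromℕ σS) {{fromℕ-positive 0<σS}}}}) ⟩
        1ℚ ℚ.* G t t′ i j                     ≡⟨ ℚ.*-identityˡ (G t t′ i j) ⟩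
        G t t′ i j                            ∎
        where open ≡.≡-Reasoning

    -- If `E t` and `E t′` agree, then `E-gram` for the pairs (t , t′) and (t , t) gives G t t′ = G
    -- t t = k𝕀 after cancelling the positive `σS`, contradicting `G-not-scalar`.
    E-injective : 0 ℕ.< k → Fin q → Injective _≡_ ℚM._≋_ E
    E-injective 0<k y {t} {t′} Et≋Et′ with t Fin.≟ t′
    ... | yes t≡t′ = t≡t′
    ... | no  t≢t′ = ⊥-elim (G-not-scalar 0<k t≢t′ G≋k𝕀 y)
      where
      open ≡.≡-Reasoning
      G≋k𝕀 : G t t′ ℚM.≋ fromℕ k ℚM.• ℚM.𝕀
      G≋k𝕀 i j = *-cancelˡ (fromℕ≢0 0<σS) (begin
        fromℕ σS ℚ.* G t t′ i j                 ≡⟨ E-gram t t′ i j ⟨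
        (E t ℚM.⊗ E t′ ℚM.ᵀ) i j                ≡⟨ ℚM.⊗-cong {A = E t} {B = E t′ ℚM.ᵀ} {B′ = E t ℚM.ᵀ} (λ _ _ → ≡.refl) (λ i j → ≡.sym (Et≋Et′ j i)) i j ⟩
        (E t ℚM.⊗ E t ℚM.ᵀ) i j                 ≡⟨ E-gram t t i j ⟩
        fromℕ σS ℚ.* G t t i j                  ≡⟨ ≡.cong (fromℕ σS ℚ.*_) (L-gram t i j) ⟩
        fromℕ σS ℚ.* (fromℕ k ℚ.* ℚM.𝕀 i j)     ∎)

open import Data.Nat.Base using (_*_; _^_; _≤_; _<_)

theorem4p8 : (q m k u : ℕ) (s : Fin u → ℕ) →
    0 < q → 0 < m → 0 < k → 0 < u → (∀ i → 0 < s i) →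
    IsPrimePower q →
    m ≤ q →
    (∃[ W ] IsWeighingMatrix m k W) →
    (∃[ D ] OrthogonalDesigns.IsOrthogonalDesign {u} m s D) →
    (∃[ D ] OrthogonalDesigns.MutuallyUnbiased {u} (m * q) (λ i → k * s i) (fromℕ (k ^ 2)) {m} D)
    ×
    ((S : Subset u) → Nonempty S →
    ∃[ W ] MutuallyQuasiUnbiased (m * q) (k * sumOver S s) (k ^ 2) (fromℕ (sumOver S s ^ 2)) {m} W)
theorem4p8 q m k u s 0<q 0<m 0<k 0<u 0<s (p , e , p-prime , 0<e , ≡.refl) m≤q (W , W-weighing) (D₀ , D₀-design) =
  (D , D-design , D-injective , λ t t′ → D-unbiased 0<k) ,
  λ S S-nonempty → let open Specialise S S-nonempty 0<s in
    E , E-weighing , E-injective 0<k y , λ t t′ → E-quasiUnbiased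
  where
  open Construction (net (prime-power-lineSystem e p-prime 0<e) m≤q) k W W-weighing s D₀ D₀-design
  y : Fin q
  y = fromℕ< 0<q
  -- Setting all variables to 1 reduces the claim to `E-injective` for the full subset, which is
  -- nonempty because `u` is positive.
  D-injective : Injective _≡_ (OrthogonalDesigns._≋_ {u}) D
  D-injective Dt≋Dt′ = E-injective 0<k y (λ i j → evaluate-cong (Dt≋Dt′ i j))
    where
    open Specialise ⊤ (fromℕ< 0<u , ∈⊤) 0<s
    open Indicator {u} ⊤
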